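{- For every $r\ge1$, let $P_r^{C}=\Phi^+(C_r)$ be the standard positive-root poset of type $C_r$, graded by $\operatorname{rk}=$ root height minus one. Then $$\mathbb{H}_{P_r^{C},\operatorname{rk}}(q,t)=\sum_{w\in\mathcal B_r}q^{\sum_{j\in D(w)}(j-1)}\,t^{|D(w)|}.$$ In particular, this $q$-Zeta numerator is coefficientwise nonnegative for every $r\ge1$.
   Context: $q$-Zeta numerator: let $P$ be a finite graded poset with a unique maximum and rank function $\rho:P\to\{0,\dots,H\}$, where $H$ is the maximal rank. For $m\ge 0$ put $A_m(P,\rho;q)=\sum_{x_1\le\cdots\le x_m}q^{\rho(x_1)+\cdots+\rho(x_m)}$ (sum over weak chains in $P$; $A_0=1$). The numerator $\mathbb{H}_{P,\rho}(q,t)$ is the polynomial determined by $\sum_{m\ge 0}A_m(P,\rho;q)t^m=\mathbb{H}_{P,\rho}(q,t)/\prod_{a=0}^{H}(1-q^at)$. Type $C_r$ in $\mathbb{R}^r$: simple roots $\alpha_i=e_i-e_{i+1}$ ($1\le i<r$), $\alpha_r=2e_r$; positive roots $e_i-e_j$ ($i<j$), $e_i+e_j$ ($i<j$), $2e_i$. Order: $\alpha\le\beta$ iff $\beta-\alpha$ is a nonnegative integer combination of simple roots. Height is the sum of simple-root coefficients. Words: a word in $\{L,R\}$ is a ballot word if every prefix contains at least as many $R$'s as $L$'s. $\mathcal B_r$ is the set of words $w\in\{L,R\}^{2r-2}$ whose reversal is a ballot word (for $r=1$, only the empty word). For $w=w_1\cdots w_m$, $D(w)=\{j: w_j=L\text{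 and }(j=1\text{ or }w_{j-1}=R)\}$. -}

module Defs where

open import Data.Bool.Base using (if_then_else_)
open import Data.Empty using (⊥)
open import Data.Fin as Fin using (Fin; zero; suc; toℕ; fromℕ<)
import Data.Fin.Properties as Finₚ
open import Data.Integer.Base as ℤ using (ℤ; 0ℤ; 1ℤ)
import Data.Integer.Properties as ℤₚ
open import Data.Integer.Tactic.RingSolver using (solve-∀)
open import Data.List.Base as List
  using (List; []; _∷_; _++_; map; foldr; filter; mapMaybe; allFin; upTo;
         cartesianProduct; cartesianProductWith; inits; length)
open import Data.List.Membership.Propositional using (_∈_)
import Data.List.Membership.Propositional.Properties as ∈ₚ
open import Data.List.Relation.Unary.All as All using (All; []; _∷_)
import Data.List.Relation.Unary.All.Properties as Allₚ
open import Data.List.Relation.Unary.AllPairs using ([]; _∷_)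
open import Data.List.Relation.Unary.Any using (here; there)
open import Data.List.Relation.Unary.Unique.Propositional using (Unique)
import Data.List.Relation.Unary.Unique.Propositional.Properties as Uniqueₚ
open import Data.Maybe.Base using (Maybe; just; nothing)
open import Data.Nat as ℕ using (ℕ; zero; suc; NonZero; z≤n; s≤s)
import Data.Nat.Properties as ℕₚ
import Data.Nat.Tactic.RingSolver as ℕSolver
open import Data.Nat.ListAction using (sum)
open import Data.Product.Base using (∃; _×_; _,_; proj₁; proj₂)
open import Data.Sum.Base using (_⊎_; inj₁; inj₂)
open import Data.Unit.Base using (⊤; tt)
open import Data.Vec.Base as Vec using (Vec; []; _∷_; lookup; toList)
open import Data.Vec.Relation.Unary.Linked using (linked?)
open import Function.Base using (_∘_)
open import Relation.Binary.Core using (Rel)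
open import Relation.Binary.Definitions using (Decidable; DecidableEquality)
open import Relation.Binary.PropositionalEquality
open import Relation.Binary.Structures using (IsDecPartialOrder)
open import Relation.Nullary using (¬_; Dec; yes; no; does; contradiction)
open import Relation.Nullary.Decidable using (map′; decidable-stable; _×-dec_; _⊎-dec_)
open import Level using (0ℓ)

open import Algebra.Bundles using (AbelianGroup)
open import Algebra.Properties.Group (AbelianGroup.group ℤₚ.+-0-abelianGroup) using (∙-cancelˡ)
import Algebra.Properties.CommutativeMonoid.Sum ℤₚ.+-0-commutativeMonoid as ℤΣ
import Algebra.Properties.CommutativeMonoid.Sum ℕₚ.+-0-commutativeMonoid as ℕΣ

𝟙 : ∀ {P : Set} → Dec P → ℕ
𝟙 d = if does d then 1 else 0

-- f i n is the coefficient of qⁱ tⁿ.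
Series : Set
Series = ℕ → ℕ → ℤ

infix  4 _≈_
infixl 7 _⊛_
infixl 6 _⊖_

_≈_ : Rel Series 0ℓ
f ≈ g = ∀ i n → f i n ≡ g i n

q^_t^_ : ℕ → ℕ → Series
(q^ a t^ b) i n = ℤ.+ (𝟙 (a ℕ.≟ i) ℕ.* 𝟙 (b ℕ.≟ n))

_⊖_ : Series → Series → Series
(f ⊖ g) i n = f i n ℤ.- g i n

_⊛_ : Series → Series → Series
(f ⊛ g) i n =
  ℤΣ.sum λ (a : Fin (suc i)) → ℤΣ.sum λ (b : Fin (suc n)) →
    f (toℕ a) (toℕ b) ℤ.* g (i ℕ.∸ toℕ a) (n ℕ.∸ toℕ b)

∑ : ∀ {A : Set} → List A → (A → Series) → Series
∑ xs f i n = foldr ℤ._+_ 0ℤ (map (λ x → f x i n) xs)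

∏ : ∀ {A : Set} → List A → (A → Series) → Series
∏ xs f = foldr _⊛_ (q^ 0 t^ 0) (map f xs)

record FiniteGradedPoset : Set₁ where
  infix 4 _≤_ _⋖_
  field
    Carrier           : Set
    _≤_               : Rel Carrier 0ℓ
    isDecPartialOrder : IsDecPartialOrder _≡_ _≤_
    elements          : List Carrier
    complete          : ∀ x → x ∈ elements
    unique            : Unique elements

  _<_ : Rel Carrier 0ℓ
  x < y = x ≤ y × x ≢ y

  _⋖_ : Rel Carrier 0ℓ
  x ⋖ y = x < y × (∀ z → ¬ (x < z × z < y))

  field
    top      : Carrier
    maximum  : ∀ x → x ≤ top
    ρ        : Carrier → ℕ
    ρ-cover  : ∀ {x y} → x ⋖ y → ρ y ≡ suc (ρ x)

  open IsDecPartialOrder isDecPartialOrder public using (_≤?_)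

  maxRank : ℕ
  maxRank = foldr ℕ._⊔_ 0 (map ρ elements)

tuples : ∀ {A : Set} → List A → ∀ m → List (Vec A m)
tuples xs zero    = [] ∷ []
tuples xs (suc m) = cartesianProductWith _∷_ xs (tuples xs m)

module _ (P : FiniteGradedPoset) where
  open FiniteGradedPoset P

  weakChains : ∀ m → List (Vec Carrier m)
  weakChains m = filter (linked? _≤?_) (tuples elements m)

  A : ℕ → Series
  A m = ∑ (weakChains m) λ xs → q^ Vec.sum (Vec.map ρ xs) t^ 0

  -- ∑_{m ≥ 0} A_m tᵐ, where A_m involves q only.
  zeta : Series
  zeta i m = A m i 0

  -- The denominator has constant term 1 in t, hence is invertible, and this
  -- product is the only series H with zeta = H / ∏ (1 - qᵃ t).
  numerator : Series
  numerator = zeta ⊛ ∏ (upTo (suc maxRank)) (λ a → (q^ 0 t^ 0) ⊖ (q^ a t^ 1))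

data Letter : Set where
  L R : Letter

_≟ᴸ_ : DecidableEquality Letter
L ≟ᴸ L = yes refl
L ≟ᴸ R = no λ ()
R ≟ᴸ L = no λ ()
R ≟ᴸ R = yes refl

Word : ℕ → Set
Word = Vec Letter

# : Letter → List Letter → ℕ
# a w = length (filter (_≟ᴸ a) w)

Ballot : List Letter → Set
Ballot w = All (λ p → # L p ℕ.≤ # R p) (inits w)

ballot? : ∀ w → Dec (Ballot w)
ballot? w = All.all? (λ p → # L p ℕ.≤? # R p) (inits w)

ℬ : ∀ r → List (Word (2 ℕ.* r ℕ.∸ 2))
ℬ r = filter (λ w → ballot? (List.reverse (toList w)))
             (tuples (L ∷ R ∷ []) (2 ℕ.* r ℕ.∸ 2))

-- Positions are counted from 0, so toℕ j is the "j - 1" of 1-based positions.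
InD : ∀ {m} → Word m → Fin m → Set
InD w j = lookup w j ≡ L × (toℕ j ≡ 0 ⊎ lookup w (Fin.pred j) ≡ R)

inD? : ∀ {m} (w : Word m) j → Dec (InD w j)
inD? w j = (lookup w j ≟ᴸ L) ×-dec
           ((toℕ j ℕ.≟ 0) ⊎-dec (lookup w (Fin.pred j) ≟ᴸ R))

D : ∀ {m} → Word m → List (Fin m)
D {m} w = filter (inD? w) (allFin m)

wordPolynomial : ℕ → Series
wordPolynomial r = ∑ (ℬ r) λ w → q^ sum (map toℕ (D w)) t^ length (D w)

-- e i is the standard basis vector of ℤʳ; indices run from 0 to r - 1.
e : ∀ {r} → Fin r → Fin r → ℤ
e i k = ℤ.+ 𝟙 (i Fin.≟ k)

simple : ∀ {r} → Fin r → Fin r → ℤ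
simple {r} i with suc (toℕ i) ℕ.<? r
... | yes i+1<r = λ k → e i k ℤ.- e (fromℕ< i+1<r) k
... | no  _     = λ k → ℤ.+ 2 ℤ.* e i k

combination : ∀ {r} → (Fin r → ℕ) → Fin r → ℤ
combination c k = ℤΣ.sum λ i → ℤ.+ c i ℤ.* simple i k

data PosRoot (r : ℕ) : Set where
  e⟨_⟩-e⟨_⟩∣_ : (i j : Fin r) → i Fin.< j → PosRoot r
  e⟨_⟩+e⟨_⟩∣_ : (i j : Fin r) → i Fin.< j → PosRoot r
  2e⟨_⟩       : Fin r → PosRoot r

vec : ∀ {r} → PosRoot r → Fin r → ℤ
vec (e⟨ i ⟩-e⟨ j ⟩∣ _) k = e i k ℤ.- e j k
vec (e⟨ i ⟩+e⟨ j ⟩∣ _) k = e i k ℤ.+ e j k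
vec 2e⟨ i ⟩            k = ℤ.+ 2 ℤ.* e i k

infix 4 _≼_

_≼_ : ∀ {r} → Rel (PosRoot r) 0ℓ
_≼_ {r} α β = ∃ λ (c : Fin r → ℕ) → ∀ k → vec β k ℤ.- vec α k ≡ combination c k

-- Coefficients of eᵢ + eⱼ, allowing i = j.  Since eᵢ is the sum of the short
-- simple roots from index i on plus half of the long one, the long simple root
-- has coefficient 1.
plusCoeff : ∀ {r} → Fin r → Fin r → Fin r → ℕ
plusCoeff {r} i j k with suc (toℕ k) ℕ.<? r
... | yes _ = 𝟙 (i Fin.≤? k) ℕ.+ 𝟙 (j Fin.≤? k)
... | no  _ = 1

coeff : ∀ {r} → PosRoot r → Fin r → ℕ
coeff (e⟨ i ⟩-e⟨ j ⟩∣ _) k = 𝟙 (i Fin.≤? k) ℕ.∸ 𝟙 (j Fin.≤? k)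
coeff (e⟨ i ⟩+e⟨ j ⟩∣ _)   = plusCoeff i j
coeff 2e⟨ i ⟩              = plusCoeff i i

ht : ∀ {r} → PosRoot r → ℕ
ht α = ℕΣ.sum (coeff α)

-- Not truncated: 1≤ht below.
rk : ∀ {r} → PosRoot r → ℕ
rk α = ht α ℕ.∸ 1

pairs : ∀ r → List (Fin r × Fin r)
pairs r = cartesianProduct (allFin r) (allFin r)

minus? plus? : ∀ {r} → Fin r × Fin r → Maybe (PosRoot r)
minus? (i , j) with i Fin.<? j
... | yes i<j = just (e⟨ i ⟩-e⟨ j ⟩∣ i<j)
... | no  _   = nothing
plus? (i , j) with i Fin.<? j
... | yes i<j = just (e⟨ i ⟩+e⟨ j ⟩∣ i<j)
... | no  _   = nothing

posRoots : ∀ r → List (PosRoot r)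
posRoots r = mapMaybe minus? (pairs r) ++ mapMaybe plus? (pairs r) ++ map 2e⟨_⟩ (allFin r)

𝟙-cong : ∀ {P Q : Set} (p : Dec P) (q : Dec Q) → (P → Q) → (Q → P) → 𝟙 p ≡ 𝟙 q
𝟙-cong (yes _) (yes _) _ _ = refl
𝟙-cong (no  _) (no  _) _ _ = refl
𝟙-cong (yes p) (no ¬q) f _ = contradiction (f p) ¬q
𝟙-cong (no ¬p) (yes q) _ g = contradiction (g q) ¬p

𝟙-yes : ∀ {P : Set} (p : Dec P) → P → 𝟙 p ≡ 1
𝟙-yes (yes _) _ = refl
𝟙-yes (no ¬p) p = contradiction p ¬p

𝟙-no : ∀ {P : Set} (p : Dec P) → ¬ P → 𝟙 p ≡ 0
𝟙-no (yes p) ¬p = contradiction p ¬p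
𝟙-no (no _)  _  = refl

𝟙-mono : ∀ {P Q : Set} (p : Dec P) (q : Dec Q) → (P → Q) → 𝟙 p ℕ.≤ 𝟙 q
𝟙-mono (no _)  _       _ = z≤n
𝟙-mono (yes _) (yes _) _ = ℕₚ.≤-refl
𝟙-mono (yes p) (no ¬q) f = contradiction (f p) ¬q

𝟙≤1 : ∀ {P : Set} (p : Dec P) → 𝟙 p ℕ.≤ 1
𝟙≤1 (yes _) = ℕₚ.≤-refl
𝟙≤1 (no _)  = z≤n

1≤𝟙 : ∀ {P : Set} (p : Dec P) → 1 ℕ.≤ 𝟙 p → P
1≤𝟙 (yes p) _ = p

combination-cong : ∀ {r} (c d : Fin r → ℕ) → c ≗ d → combination c ≗ combination d
combination-cong c d c≗d k = ℤΣ.sum-cong-≗ λ i → cong (λ x → ℤ.+ x ℤ.* simple i k) (c≗d i)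

combination-+ : ∀ {r} (c d : Fin r → ℕ) k →
                combination (λ i → c i ℕ.+ d i) k ≡ combination c k ℤ.+ combination d k
combination-+ c d k = trans
  (ℤΣ.sum-cong-≗ λ i → ℤₚ.*-distribʳ-+ (simple i k) (ℤ.+ c i) (ℤ.+ d i))
  (ℤΣ.∑-distrib-+ (λ i → ℤ.+ c i ℤ.* simple i k) (λ i → ℤ.+ d i ℤ.* simple i k))

simple-suc-zero : ∀ {r} (i : Fin (suc r)) → simple (suc i) zero ≡ 0ℤ
simple-suc-zero {r} i with suc (toℕ (suc i)) ℕ.<? suc (suc r)
... | yes _ = refl
... | no  _ = refl

simple-suc-suc : ∀ {r} (i k : Fin r) → simple (suc i) (suc k) ≡ simple i k
simple-suc-suc {r} i k with suc (toℕ (suc i)) ℕ.<? suc r | suc (toℕ i) ℕ.<? r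
... | yes _       | yes _   = refl
... | no  _       | no  _   = refl
... | yes (s≤s p) | no ¬p   = contradiction p ¬p
... | no ¬p       | yes p   = contradiction (s≤s p) ¬p

combination-zero : ∀ {r} (c : Fin (suc (suc r)) → ℕ) → combination c zero ≡ ℤ.+ c zero
combination-zero {r} c = begin
  ℤ.+ c zero ℤ.* 1ℤ ℤ.+ ℤΣ.sum (λ i → ℤ.+ c (suc i) ℤ.* simple (suc i) zero)
    ≡⟨ cong₂ ℤ._+_ (ℤₚ.*-identityʳ (ℤ.+ c zero)) (ℤΣ.sum-cong-≗ {suc r} λ i →
         trans (cong (λ x → ℤ.+ c (suc i) ℤ.* x) (simple-suc-zero i)) (ℤₚ.*-zeroʳ (ℤ.+ c (suc i)))) ⟩
  ℤ.+ c zero ℤ.+ ℤΣ.sum (λ (i : Fin (suc r)) → 0ℤ)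
    ≡⟨ cong (λ x → ℤ.+ c zero ℤ.+ x) (ℤΣ.sum-replicate-zero (suc r)) ⟩
  ℤ.+ c zero ℤ.+ 0ℤ
    ≡⟨ ℤₚ.+-identityʳ _ ⟩
  ℤ.+ c zero ∎
  where open ≡-Reasoning

combination-suc : ∀ {r} (c : Fin (suc r) → ℕ) k →
                  combination c (suc k) ≡
                  ℤ.+ c zero ℤ.* simple zero (suc k) ℤ.+ combination (c ∘ suc) k
combination-suc c k = cong (λ x → ℤ.+ c zero ℤ.* simple zero (suc k) ℤ.+ x)
  (ℤΣ.sum-cong-≗ λ i → cong (λ x → ℤ.+ c (suc i) ℤ.* x) (simple-suc-suc i k))

combination-injective : ∀ {r} (c d : Fin r → ℕ) → combination c ≗ combination d → c ≗ d
combination-injective {suc zero} c d eq zero =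
  ℤₚ.+-injective (ℤₚ.*-cancelʳ-≡ _ _ (ℤ.+ 2)
    (trans (sym (ℤₚ.+-identityʳ _)) (trans (eq zero) (ℤₚ.+-identityʳ _))))
combination-injective {suc (suc r)} c d eq = λ
  { zero    → c₀≡d₀
  ; (suc k) → combination-injective (c ∘ suc) (d ∘ suc) tail≗ k
  }
  where
  c₀≡d₀ : c zero ≡ d zero
  c₀≡d₀ = ℤₚ.+-injective
    (trans (sym (combination-zero c)) (trans (eq zero) (combination-zero d)))
  tail≗ : combination (c ∘ suc) ≗ combination (d ∘ suc)
  tail≗ k = ∙-cancelˡ (ℤ.+ c zero ℤ.* simple zero (suc k)) _ _ (begin
    ℤ.+ c zero ℤ.* simple zero (suc k) ℤ.+ combination (c ∘ suc) k  ≡⟨ combination-suc c k ⟨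
    combination c (suc k)                                          ≡⟨ eq (suc k) ⟩
    combination d (suc k)                                          ≡⟨ combination-suc d k ⟩
    ℤ.+ d zero ℤ.* simple zero (suc k) ℤ.+ combination (d ∘ suc) k
      ≡⟨ cong (λ x → ℤ.+ x ℤ.* simple zero (suc k) ℤ.+ combination (d ∘ suc) k) c₀≡d₀ ⟨
    ℤ.+ c zero ℤ.* simple zero (suc k) ℤ.+ combination (d ∘ suc) k  ∎)
    where open ≡-Reasoning

plusCoeff-suc : ∀ {r} (i j k : Fin r) → plusCoeff (suc i) (suc j) (suc k) ≡ plusCoeff i j k
plusCoeff-suc {r} i j k with suc (toℕ (suc k)) ℕ.<? suc r | suc (toℕ k) ℕ.<? r
... | yes _       | yes _ = cong₂ ℕ._+_
        (𝟙-cong (suc i Fin.≤? suc k) (i Fin.≤? k) ℕ.s≤s⁻¹ s≤s)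
        (𝟙-cong (suc j Fin.≤? suc k) (j Fin.≤? k) ℕ.s≤s⁻¹ s≤s)
... | no  _       | no  _ = refl
... | yes (s≤s p) | no ¬p = contradiction p ¬p
... | no ¬p       | yes p = contradiction (s≤s p) ¬p

plusCoeff-zero-suc : ∀ {r} (k : Fin (suc r)) → plusCoeff zero zero (suc k) ≡ plusCoeff zero zero k
plusCoeff-zero-suc {r} k with suc (toℕ (suc k)) ℕ.<? suc (suc r) | suc (toℕ k) ℕ.<? suc r
... | yes _       | yes _ = refl
... | no  _       | no  _ = refl
... | yes (s≤s p) | no ¬p = contradiction p ¬p
... | no ¬p       | yes p = contradiction (s≤s p) ¬p

double-expansion : ∀ {r} (i : Fin r) k → combination (plusCoeff i i) k ≡ ℤ.+ 2 ℤ.* e i k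
double-expansion {suc zero}    zero    zero    = refl
double-expansion {suc (suc r)} zero    zero    = combination-zero {r} (plusCoeff zero zero)
double-expansion {suc (suc r)} zero    (suc k) = begin
  combination (plusCoeff zero zero) (suc k)
    ≡⟨ combination-suc {suc r} (plusCoeff zero zero) k ⟩
  ℤ.+ 2 ℤ.* (0ℤ ℤ.- e zero k) ℤ.+ combination (λ i → plusCoeff zero zero (suc i)) k
    ≡⟨ cong (λ x → ℤ.+ 2 ℤ.* (0ℤ ℤ.- e zero k) ℤ.+ x)
         (trans (combination-cong _ (plusCoeff zero zero) plusCoeff-zero-suc k) (double-expansion zero k)) ⟩
  ℤ.+ 2 ℤ.* (0ℤ ℤ.- e zero k) ℤ.+ ℤ.+ 2 ℤ.* e zero k
    ≡⟨ lemma (e zero k) ⟩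
  0ℤ ∎
  where
  open ≡-Reasoning
  lemma : ∀ x → ℤ.+ 2 ℤ.* (0ℤ ℤ.- x) ℤ.+ ℤ.+ 2 ℤ.* x ≡ 0ℤ
  lemma = solve-∀
double-expansion {suc (suc r)} (suc i) zero    = combination-zero {r} (plusCoeff (suc i) (suc i))
double-expansion {suc (suc r)} (suc i) (suc k) = begin
  combination (plusCoeff (suc i) (suc i)) (suc k)
    ≡⟨ combination-suc {suc r} (plusCoeff (suc i) (suc i)) k ⟩
  0ℤ ℤ.+ combination (λ i′ → plusCoeff (suc i) (suc i) (suc i′)) k
    ≡⟨ ℤₚ.+-identityˡ _ ⟩
  combination (λ i′ → plusCoeff (suc i) (suc i) (suc i′)) k
    ≡⟨ combination-cong _ (plusCoeff i i) (plusCoeff-suc i i) k ⟩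
  combination (plusCoeff i i) k
    ≡⟨ double-expansion i k ⟩
  ℤ.+ 2 ℤ.* e i k ∎
  where open ≡-Reasoning

plusCoeff-double : ∀ {r} (i j k : Fin r) →
                   plusCoeff i j k ℕ.+ plusCoeff i j k ≡ plusCoeff i i k ℕ.+ plusCoeff j j k
plusCoeff-double {r} i j k with suc (toℕ k) ℕ.<? r
... | yes _ = lemma (𝟙 (i Fin.≤? k)) (𝟙 (j Fin.≤? k))
  where
  lemma : ∀ x y → (x ℕ.+ y) ℕ.+ (x ℕ.+ y) ≡ (x ℕ.+ x) ℕ.+ (y ℕ.+ y)
  lemma = ℕSolver.solve-∀
... | no  _ = refl

last≥ : ∀ {r} {k : Fin r} → ¬ (suc (toℕ k) ℕ.< r) → (i : Fin r) → i Fin.≤ k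
last≥ {suc r} ¬p i = ℕₚ.≤-trans (ℕ.s≤s⁻¹ (Finₚ.toℕ<n i)) (ℕ.s≤s⁻¹ (ℕ.s≤s⁻¹ (ℕₚ.≰⇒> ¬p)))

minusCoeff-double : ∀ {r} (i j k : Fin r) → i Fin.< j →
  ((𝟙 (i Fin.≤? k) ℕ.∸ 𝟙 (j Fin.≤? k)) ℕ.+ (𝟙 (i Fin.≤? k) ℕ.∸ 𝟙 (j Fin.≤? k)))
    ℕ.+ plusCoeff j j k ≡ plusCoeff i i k
minusCoeff-double {r} i j k i<j with suc (toℕ k) ℕ.<? r
... | no ¬p rewrite 𝟙-yes (i Fin.≤? k) (last≥ ¬p i) | 𝟙-yes (j Fin.≤? k) (last≥ ¬p j) = refl
... | yes _ = lemma (i Fin.≤? k) (j Fin.≤? k) (ℕₚ.≤-trans (ℕₚ.<⇒≤ i<j))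
  where
  lemma : ∀ {P Q : Set} (p : Dec P) (q : Dec Q) → (Q → P) →
          (𝟙 p ℕ.∸ 𝟙 q) ℕ.+ (𝟙 p ℕ.∸ 𝟙 q) ℕ.+ (𝟙 q ℕ.+ 𝟙 q) ≡ 𝟙 p ℕ.+ 𝟙 p
  lemma (yes _) (yes _) _ = refl
  lemma (yes _) (no  _) _ = refl
  lemma (no  _) (no  _) _ = refl
  lemma (no ¬p) (yes q) f = contradiction (f q) ¬p

-- With combination-injective: coeff α is the unique expansion of α.
coeff-expansion : ∀ {r} (α : PosRoot r) → combination (coeff α) ≗ vec α
coeff-expansion α@(e⟨ i ⟩-e⟨ j ⟩∣ i<j) k = ℤₚ.*-cancelˡ-≡ (ℤ.+ 2) _ _ (begin
  ℤ.+ 2 ℤ.* x                       ≡⟨ l₁ x y ⟩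
  (x ℤ.+ x ℤ.+ y) ℤ.- y             ≡⟨ cong (ℤ._- y) x+x+y≡z ⟩
  combination (plusCoeff i i) k ℤ.- y  ≡⟨ cong₂ ℤ._-_ (double-expansion i k) (double-expansion j k) ⟩
  ℤ.+ 2 ℤ.* e i k ℤ.- ℤ.+ 2 ℤ.* e j k  ≡⟨ l₂ (e i k) (e j k) ⟩
  ℤ.+ 2 ℤ.* (e i k ℤ.- e j k)       ∎)
  where
  open ≡-Reasoning
  x = combination (coeff α) k
  y = combination (plusCoeff j j) k
  x+x+y≡z : x ℤ.+ x ℤ.+ y ≡ combination (plusCoeff i i) k
  x+x+y≡z = begin
    x ℤ.+ x ℤ.+ y
      ≡⟨ cong (ℤ._+ y) (combination-+ (coeff α) (coeff α) k) ⟨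
    combination (λ l → coeff α l ℕ.+ coeff α l) k ℤ.+ y
      ≡⟨ combination-+ (λ l → coeff α l ℕ.+ coeff α l) (plusCoeff j j) k ⟨
    combination (λ l → coeff α l ℕ.+ coeff α l ℕ.+ plusCoeff j j l) k
      ≡⟨ combination-cong _ (plusCoeff i i) (λ l → minusCoeff-double i j l i<j) k ⟩
    combination (plusCoeff i i) k ∎
  l₁ : ∀ x y → ℤ.+ 2 ℤ.* x ≡ (x ℤ.+ x ℤ.+ y) ℤ.- y
  l₁ = solve-∀
  l₂ : ∀ x y → ℤ.+ 2 ℤ.* x ℤ.- ℤ.+ 2 ℤ.* y ≡ ℤ.+ 2 ℤ.* (x ℤ.- y)
  l₂ = solve-∀
coeff-expansion (e⟨ i ⟩+e⟨ j ⟩∣ _) k = ℤₚ.*-cancelˡ-≡ (ℤ.+ 2) _ _ (begin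
  ℤ.+ 2 ℤ.* x
    ≡⟨ l₁ x ⟩
  x ℤ.+ x
    ≡⟨ combination-+ (plusCoeff i j) (plusCoeff i j) k ⟨
  combination (λ l → plusCoeff i j l ℕ.+ plusCoeff i j l) k
    ≡⟨ combination-cong _ _ (plusCoeff-double i j) k ⟩
  combination (λ l → plusCoeff i i l ℕ.+ plusCoeff j j l) k
    ≡⟨ combination-+ (plusCoeff i i) (plusCoeff j j) k ⟩
  combination (plusCoeff i i) k ℤ.+ combination (plusCoeff j j) k
    ≡⟨ cong₂ ℤ._+_ (double-expansion i k) (double-expansion j k) ⟩
  ℤ.+ 2 ℤ.* e i k ℤ.+ ℤ.+ 2 ℤ.* e j k
    ≡⟨ ℤₚ.*-distribˡ-+ (ℤ.+ 2) (e i k) (e j k) ⟨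
  ℤ.+ 2 ℤ.* (e i k ℤ.+ e j k) ∎)
  where
  open ≡-Reasoning
  x = combination (plusCoeff i j) k
  l₁ : ∀ x → ℤ.+ 2 ℤ.* x ≡ x ℤ.+ x
  l₁ = solve-∀
coeff-expansion 2e⟨ i ⟩ k = double-expansion i k

infix 4 _≼ᶜ_

_≼ᶜ_ : ∀ {r} → Rel (PosRoot r) 0ℓ
α ≼ᶜ β = ∀ k → coeff α k ℕ.≤ coeff β k

≼⇒≼ᶜ : ∀ {r} {α β : PosRoot r} → α ≼ β → α ≼ᶜ β
≼⇒≼ᶜ {α = α} {β} (c , eq) k = subst (coeff α k ℕ.≤_) (combination-injective (λ i → c i ℕ.+ coeff α i) (coeff β) sum≗ k) (ℕₚ.m≤n+m _ (c k))
  where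
  open ≡-Reasoning
  l : ∀ x y → y ℤ.- x ℤ.+ x ≡ y
  l = solve-∀
  sum≗ : combination (λ i → c i ℕ.+ coeff α i) ≗ combination (coeff β)
  sum≗ k = begin
    combination (λ i → c i ℕ.+ coeff α i) k        ≡⟨ combination-+ c (coeff α) k ⟩
    combination c k ℤ.+ combination (coeff α) k     ≡⟨ cong₂ ℤ._+_ (sym (eq k)) (coeff-expansion α k) ⟩
    vec β k ℤ.- vec α k ℤ.+ vec α k                 ≡⟨ l (vec α k) (vec β k) ⟩
    vec β k                                         ≡⟨ coeff-expansion β k ⟨
    combination (coeff β) k                         ∎

≼ᶜ⇒≼ : ∀ {r} {α β : PosRoot r} → α ≼ᶜ β → α ≼ β
≼ᶜ⇒≼ {α = α} {β} α≤β = c , λ k → begin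
  vec β k ℤ.- vec α k
    ≡⟨ cong₂ ℤ._-_ (coeff-expansion β k) (coeff-expansion α k) ⟨
  combination (coeff β) k ℤ.- combination (coeff α) k
    ≡⟨ cong (ℤ._- combination (coeff α) k) (combination-cong _ (coeff β) (λ i → ℕₚ.m∸n+n≡m (α≤β i)) k) ⟨
  combination (λ i → c i ℕ.+ coeff α i) k ℤ.- combination (coeff α) k
    ≡⟨ cong (ℤ._- combination (coeff α) k) (combination-+ c (coeff α) k) ⟩
  combination c k ℤ.+ combination (coeff α) k ℤ.- combination (coeff α) k
    ≡⟨ l (combination c k) (combination (coeff α) k) ⟩
  combination c k ∎
  where
  open ≡-Reasoning
  c = λ i → coeff β i ℕ.∸ coeff α i
  l : ∀ x y → x ℤ.+ y ℤ.- y ≡ x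
  l = solve-∀

_≼?_ : ∀ {r} → Decidable (_≼_ {r})
α ≼? β = map′ (≼ᶜ⇒≼ {α = α} {β}) (≼⇒≼ᶜ {α = α} {β}) (Finₚ.all? λ k → coeff α k ℕ.≤? coeff β k)

lo : ∀ {r} → PosRoot r → Fin r
lo (e⟨ i ⟩-e⟨ _ ⟩∣ _) = i
lo (e⟨ i ⟩+e⟨ _ ⟩∣ _) = i
lo 2e⟨ i ⟩            = i

-- eᵢ - eⱼ has tip inj₁ j, while eᵢ + eⱼ and (for i = j) 2eᵢ have tip inj₂ j.
Tip : ℕ → Set
Tip r = Fin r ⊎ Fin r

tip : ∀ {r} → PosRoot r → Tip r
tip (e⟨ _ ⟩-e⟨ j ⟩∣ _) = inj₁ j
tip (e⟨ _ ⟩+e⟨ j ⟩∣ _) = inj₂ j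
tip 2e⟨ i ⟩            = inj₂ i

Valid : ∀ {r} → Fin r → Tip r → Set
Valid i (inj₁ j) = i Fin.< j
Valid i (inj₂ j) = i Fin.≤ j

valid : ∀ {r} (α : PosRoot r) → Valid (lo α) (tip α)
valid (e⟨ _ ⟩-e⟨ _ ⟩∣ i<j) = i<j
valid (e⟨ _ ⟩+e⟨ _ ⟩∣ i<j) = ℕₚ.<⇒≤ i<j
valid 2e⟨ _ ⟩              = ℕₚ.≤-refl

root : ∀ {r} (i : Fin r) t → Valid i t → ∃ λ (α : PosRoot r) → lo α ≡ i × tip α ≡ t
root i (inj₁ j) i<j = e⟨ i ⟩-e⟨ j ⟩∣ i<j , refl , refl
root i (inj₂ j) i≤j with ℕₚ.m≤n⇒m<n∨m≡n i≤j
... | inj₁ i<j = e⟨ i ⟩+e⟨ j ⟩∣ i<j , refl , refl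
... | inj₂ i≡j with refl ← Finₚ.toℕ-injective i≡j = 2e⟨ i ⟩ , refl , refl

root-unique : ∀ {r} (α β : PosRoot r) → lo α ≡ lo β → tip α ≡ tip β → α ≡ β
root-unique (e⟨ _ ⟩-e⟨ _ ⟩∣ p) (e⟨ _ ⟩-e⟨ _ ⟩∣ q) refl refl = cong (e⟨ _ ⟩-e⟨ _ ⟩∣_) (ℕₚ.<-irrelevant p q)
root-unique (e⟨ _ ⟩+e⟨ _ ⟩∣ p) (e⟨ _ ⟩+e⟨ _ ⟩∣ q) refl refl = cong (e⟨ _ ⟩+e⟨ _ ⟩∣_) (ℕₚ.<-irrelevant p q)
root-unique (e⟨ _ ⟩+e⟨ _ ⟩∣ p) 2e⟨ _ ⟩            refl refl = contradiction p (ℕₚ.<-irrefl refl)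
root-unique 2e⟨ _ ⟩            (e⟨ _ ⟩+e⟨ _ ⟩∣ q) refl refl = contradiction q (ℕₚ.<-irrefl refl)
root-unique 2e⟨ _ ⟩            2e⟨ _ ⟩            refl refl = refl

tipCoeff : ∀ {r} → Fin r → Tip r → Fin r → ℕ
tipCoeff i (inj₁ j) k = 𝟙 (i Fin.≤? k) ℕ.∸ 𝟙 (j Fin.≤? k)
tipCoeff i (inj₂ j)   = plusCoeff i j

coeff≡tipCoeff : ∀ {r} (α : PosRoot r) → coeff α ≡ tipCoeff (lo α) (tip α)
coeff≡tipCoeff (e⟨ _ ⟩-e⟨ _ ⟩∣ _) = refl
coeff≡tipCoeff (e⟨ _ ⟩+e⟨ _ ⟩∣ _) = refl
coeff≡tipCoeff 2e⟨ _ ⟩            = refl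

infix 4 _⊑_

_⊑_ : ∀ {r} → Tip r → Tip r → Set
inj₁ j ⊑ inj₁ j′ = j Fin.≤ j′
inj₁ _ ⊑ inj₂ _  = ⊤
inj₂ _ ⊑ inj₁ _  = ⊥
inj₂ j ⊑ inj₂ j′ = j′ Fin.≤ j

⊑-refl : ∀ {r} (t : Tip r) → t ⊑ t
⊑-refl (inj₁ _) = ℕₚ.≤-refl
⊑-refl (inj₂ _) = ℕₚ.≤-refl

⊑-antisym : ∀ {r} (s t : Tip r) → s ⊑ t → t ⊑ s → s ≡ t
⊑-antisym (inj₁ _) (inj₁ _) p q = cong inj₁ (Finₚ.toℕ-injective (ℕₚ.≤-antisym p q))
⊑-antisym (inj₂ _) (inj₂ _) p q = cong inj₂ (Finₚ.toℕ-injective (ℕₚ.≤-antisym q p))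

plusCoeff-notLast : ∀ {r} (i j k : Fin r) → suc (toℕ k) ℕ.< r →
                    plusCoeff i j k ≡ 𝟙 (i Fin.≤? k) ℕ.+ 𝟙 (j Fin.≤? k)
plusCoeff-notLast {r} i j k p with suc (toℕ k) ℕ.<? r
... | yes _ = refl
... | no ¬p = contradiction p ¬p

plusCoeff-last : ∀ {r} (i j k : Fin r) → ¬ suc (toℕ k) ℕ.< r → plusCoeff i j k ≡ 1
plusCoeff-last {r} i j k ¬p with suc (toℕ k) ℕ.<? r
... | yes p = contradiction p ¬p
... | no _  = refl

tipCoeff-mono : ∀ {r} (i i′ : Fin r) s t → i′ Fin.≤ i → s ⊑ t → ∀ k → tipCoeff i s k ℕ.≤ tipCoeff i′ t k
tipCoeff-mono i i′ (inj₁ j) (inj₁ j′) p q k =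
  ℕₚ.∸-mono (𝟙-mono (i Fin.≤? k) (i′ Fin.≤? k) (ℕₚ.≤-trans p))
            (𝟙-mono (j′ Fin.≤? k) (j Fin.≤? k) (ℕₚ.≤-trans q))
tipCoeff-mono {r} i i′ (inj₁ j) (inj₂ j′) p q k with suc (toℕ k) ℕ.<? r
... | yes _ = ℕₚ.≤-trans (ℕₚ.m∸n≤m _ (𝟙 (j Fin.≤? k)))
                (ℕₚ.≤-trans (𝟙-mono (i Fin.≤? k) (i′ Fin.≤? k) (ℕₚ.≤-trans p)) (ℕₚ.m≤m+n _ _))
... | no  _ = ℕₚ.≤-trans (ℕₚ.m∸n≤m _ (𝟙 (j Fin.≤? k))) (𝟙≤1 (i Fin.≤? k))
tipCoeff-mono {r} i i′ (inj₂ j) (inj₂ j′) p q k with suc (toℕ k) ℕ.<? r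
... | yes _ = ℕₚ.+-mono-≤ (𝟙-mono (i Fin.≤? k) (i′ Fin.≤? k) (ℕₚ.≤-trans p))
                          (𝟙-mono (j Fin.≤? k) (j′ Fin.≤? k) (ℕₚ.≤-trans q))
... | no  _ = ℕₚ.≤-refl

1≤tipCoeff-lo : ∀ {r} (i : Fin r) t → Valid i t → 1 ℕ.≤ tipCoeff i t i
1≤tipCoeff-lo i (inj₁ j) i<j
  rewrite 𝟙-yes (i Fin.≤? i) ℕₚ.≤-refl | 𝟙-no (j Fin.≤? i) (ℕₚ.<⇒≱ i<j) = ℕₚ.≤-refl
1≤tipCoeff-lo {r} i (inj₂ j) _ with suc (toℕ i) ℕ.<? r
... | yes _ rewrite 𝟙-yes (i Fin.≤? i) ℕₚ.≤-refl = s≤s z≤n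
... | no  _ = ℕₚ.≤-refl

lo-lower : ∀ {r} (i : Fin r) t k → Valid i t → 1 ℕ.≤ tipCoeff i t k → i Fin.≤ k
lo-lower i (inj₁ j) k _ p = 1≤𝟙 (i Fin.≤? k) (ℕₚ.≤-trans p (ℕₚ.m∸n≤m _ (𝟙 (j Fin.≤? k))))
lo-lower {r} i (inj₂ j) k i≤j p with suc (toℕ k) ℕ.<? r
... | no ¬q = last≥ ¬q i
... | yes _ = lemma (i Fin.≤? k) (j Fin.≤? k) p (ℕₚ.≤-trans i≤j)
  where
  lemma : ∀ {P Q : Set} (p : Dec P) (q : Dec Q) → 1 ℕ.≤ 𝟙 p ℕ.+ 𝟙 q → (Q → P) → P
  lemma (yes p) _       _ _ = p
  lemma (no  _) (yes q) _ f = f q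

tip-mono : ∀ {r} (i i′ : Fin r) s t → Valid i s → Valid i′ t →
           (∀ k → tipCoeff i s k ℕ.≤ tipCoeff i′ t k) → s ⊑ t
tip-mono i i′ (inj₁ (suc j)) (inj₁ j′) i<j _ f = ℕₚ.≰⇒> λ j′≤j →
  contradiction (ℕₚ.≤-trans 1≤c (f (Fin.inject₁ j))) (λ 1≤c′ → lemma (i′ Fin.≤? k) (j′ Fin.≤? k) 1≤c′
    (subst (toℕ j′ ℕ.≤_) (sym (Finₚ.toℕ-inject₁ j)) j′≤j))
  where
  k = Fin.inject₁ j
  1≤c : 1 ℕ.≤ tipCoeff i (inj₁ (suc j)) k
  1≤c rewrite 𝟙-yes (i Fin.≤? k) (subst (toℕ i ℕ.≤_) (sym (Finₚ.toℕ-inject₁ j)) (ℕ.s≤s⁻¹ i<j))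
            | 𝟙-no (suc j Fin.≤? k) (λ p → ℕₚ.<-irrefl refl (subst (suc (toℕ j) ℕ.≤_) (Finₚ.toℕ-inject₁ j) p))
            = ℕₚ.≤-refl
  lemma : ∀ {P Q : Set} (p : Dec P) (q : Dec Q) → 1 ℕ.≤ 𝟙 p ℕ.∸ 𝟙 q → ¬ Q
  lemma _       (no ¬q) _  = ¬q
  lemma (yes _) (yes _) ()
  lemma (no  _) (yes _) ()
tip-mono i i′ (inj₁ _) (inj₂ _) _ _ _ = _
tip-mono {suc n} i i′ (inj₂ j) (inj₁ j′) _ _ f = contradiction (f k) lemma
  where
  k = Fin.fromℕ n
  ¬p : ¬ suc (toℕ k) ℕ.< suc n
  ¬p p = ℕₚ.<-irrefl (Finₚ.toℕ-fromℕ n) (ℕ.s<s⁻¹ p)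
  lemma : ¬ plusCoeff i j k ℕ.≤ tipCoeff i′ (inj₁ j′) k
  lemma rewrite plusCoeff-last i j k ¬p
              | 𝟙-yes (i′ Fin.≤? k) (last≥ ¬p i′) | 𝟙-yes (j′ Fin.≤? k) (last≥ ¬p j′) = λ ()
tip-mono {r} i i′ (inj₂ j) (inj₂ j′) i≤j _ f with suc (toℕ j) ℕ.<? r | f j
... | no ¬p | _  = last≥ ¬p j′
... | yes p | fj = 1≤𝟙 (j′ Fin.≤? j) (ℕ.s≤s⁻¹ (ℕₚ.≤-trans 2≤ (ℕₚ.+-monoˡ-≤ (𝟙 (j′ Fin.≤? j)) (𝟙≤1 (i′ Fin.≤? j)))))
  where
  2≤ : 2 ℕ.≤ 𝟙 (i′ Fin.≤? j) ℕ.+ 𝟙 (j′ Fin.≤? j)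
  2≤ = subst (ℕ._≤ (𝟙 (i′ Fin.≤? j) ℕ.+ 𝟙 (j′ Fin.≤? j))) (cong₂ ℕ._+_ (𝟙-yes (i Fin.≤? j) i≤j) (𝟙-yes (j Fin.≤? j) ℕₚ.≤-refl)) fj

infix 4 _≼ᵉ_

_≼ᵉ_ : ∀ {r} → Rel (PosRoot r) 0ℓ
α ≼ᵉ β = lo β Fin.≤ lo α × tip α ⊑ tip β

≼ᵉ⇒≼ : ∀ {r} {α β : PosRoot r} → α ≼ᵉ β → α ≼ β
≼ᵉ⇒≼ {α = α} {β} (p , q) = ≼ᶜ⇒≼ {α = α} {β} λ k →
  subst₂ (λ c d → c k ℕ.≤ d k) (sym (coeff≡tipCoeff α)) (sym (coeff≡tipCoeff β))
    (tipCoeff-mono (lo α) (lo β) (tip α) (tip β) p q k)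

≼⇒≼ᵉ : ∀ {r} {α β : PosRoot r} → α ≼ β → α ≼ᵉ β
≼⇒≼ᵉ {α = α} {β} α≼β =
  lo-lower (lo β) (tip β) (lo α) (valid β)
    (ℕₚ.≤-trans (1≤tipCoeff-lo (lo α) (tip α) (valid α)) (c≤ (lo α))) ,
  tip-mono (lo α) (lo β) (tip α) (tip β) (valid α) (valid β) c≤
  where
  c≤ : ∀ k → tipCoeff (lo α) (tip α) k ℕ.≤ tipCoeff (lo β) (tip β) k
  c≤ k = subst₂ (λ c d → c k ℕ.≤ d k) (coeff≡tipCoeff α) (coeff≡tipCoeff β)
           (≼⇒≼ᶜ {α = α} {β} α≼β k)

≼-refl : ∀ {r} (α : PosRoot r) → α ≼ α
≼-refl α = ≼ᶜ⇒≼ {α = α} {α} λ _ → ℕₚ.≤-refl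

≼-trans : ∀ {r} {α β γ : PosRoot r} → α ≼ β → β ≼ γ → α ≼ γ
≼-trans {α = α} {β} {γ} p q = ≼ᶜ⇒≼ {α = α} {γ} λ k →
  ℕₚ.≤-trans (≼⇒≼ᶜ {α = α} {β} p k) (≼⇒≼ᶜ {α = β} {γ} q k)

≼-antisym : ∀ {r} {α β : PosRoot r} → α ≼ β → β ≼ α → α ≡ β
≼-antisym {α = α} {β} p q = root-unique α β
  (Finₚ.toℕ-injective (ℕₚ.≤-antisym (proj₁ β≼α) (proj₁ α≼β)))
  (⊑-antisym (tip α) (tip β) (proj₂ α≼β) (proj₂ β≼α))
  where
  α≼β = ≼⇒≼ᵉ {α = α} {β} p
  β≼α = ≼⇒≼ᵉ {α = β} {α} q

≼-isDecPartialOrder : ∀ r → IsDecPartialOrder _≡_ (_≼_ {r})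
≼-isDecPartialOrder r = record
  { isPartialOrder = record
    { isPreorder = record
      { isEquivalence = isEquivalence
      ; reflexive     = λ { {α} refl → ≼-refl α }
      ; trans         = λ {α} {β} {γ} → ≼-trans {α = α} {β} {γ}
      }
    ; antisym = λ {α} {β} → ≼-antisym {α = α} {β}
    }
  ; _≟_ = λ α β → map′ (λ (p , q) → ≼-antisym {α = α} {β} p q)
                       (λ { refl → ≼-refl α , ≼-refl α })
                       ((α ≼? β) ×-dec (β ≼? α))
  ; _≤?_ = _≼?_
  }

sum-𝟙 : ∀ {r} (i : Fin r) → ℕΣ.sum (λ (k : Fin r) → 𝟙 (i Fin.≤? k)) ℕ.+ toℕ i ≡ r
sum-𝟙 {suc r} zero = trans (ℕₚ.+-identityʳ (ℕΣ.sum {suc r} (λ _ → 1))) (ones (suc r))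
  where
  ones : ∀ r → ℕΣ.sum {r} (λ _ → 1) ≡ r
  ones zero    = refl
  ones (suc r) = cong suc (ones r)
sum-𝟙 {suc r} (suc i) = trans (ℕₚ.+-suc _ (toℕ i)) (cong suc (trans
  (cong (ℕ._+ toℕ i) (ℕΣ.sum-cong-≗ {r} λ k → 𝟙-cong (suc i Fin.≤? suc k) (i Fin.≤? k) ℕ.s≤s⁻¹ s≤s))
  (sum-𝟙 i)))

sum-minus : ∀ {r} (i j : Fin r) → i Fin.< j → ℕΣ.sum (tipCoeff i (inj₁ j)) ℕ.+ toℕ i ≡ toℕ j
sum-minus {r} i j i<j = ℕₚ.+-cancelˡ-≡ S _ _ (begin
  S ℕ.+ (ℕΣ.sum (tipCoeff i (inj₁ j)) ℕ.+ toℕ i)   ≡⟨ l S (ℕΣ.sum (tipCoeff i (inj₁ j))) (toℕ i) ⟩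
  ℕΣ.sum (tipCoeff i (inj₁ j)) ℕ.+ S ℕ.+ toℕ i
    ≡⟨ cong (ℕ._+ toℕ i) (ℕΣ.∑-distrib-+ {r} (tipCoeff i (inj₁ j)) (λ (k : Fin r) → 𝟙 (j Fin.≤? k))) ⟨
  ℕΣ.sum (λ (k : Fin r) → tipCoeff i (inj₁ j) k ℕ.+ 𝟙 (j Fin.≤? k)) ℕ.+ toℕ i
    ≡⟨ cong (ℕ._+ toℕ i) (ℕΣ.sum-cong-≗ {r} λ k → ℕₚ.m∸n+n≡m
         (𝟙-mono (j Fin.≤? k) (i Fin.≤? k) (ℕₚ.≤-trans (ℕₚ.<⇒≤ i<j)))) ⟩
  ℕΣ.sum (λ (k : Fin r) → 𝟙 (i Fin.≤? k)) ℕ.+ toℕ i            ≡⟨ sum-𝟙 i ⟩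
  r                                                  ≡⟨ sum-𝟙 j ⟨
  S ℕ.+ toℕ j ∎)
  where
  open ≡-Reasoning
  S = ℕΣ.sum (λ (k : Fin r) → 𝟙 (j Fin.≤? k))
  l : ∀ x y z → x ℕ.+ (y ℕ.+ z) ≡ y ℕ.+ x ℕ.+ z
  l = ℕSolver.solve-∀

sum-adjustLast : ∀ {n} (f g : Fin (suc n) → ℕ) →
  (∀ k → suc (toℕ k) ℕ.< suc n → f k ≡ g k) →
  (∀ k → ¬ suc (toℕ k) ℕ.< suc n → suc (f k) ≡ g k) →
  suc (ℕΣ.sum f) ≡ ℕΣ.sum g
sum-adjustLast {zero}  f g _ q = cong (ℕ._+ 0) (q zero λ { (s≤s ()) })
sum-adjustLast {suc n} f g p q = trans (sym (ℕₚ.+-suc (f zero) _)) (cong₂ ℕ._+_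
  (p zero (s≤s (s≤s z≤n)))
  (sum-adjustLast (f ∘ suc) (g ∘ suc) (λ k k< → p (suc k) (s≤s k<)) (λ k k≮ → q (suc k) (k≮ ∘ ℕ.s≤s⁻¹))))

sum-plus : ∀ {r} (i j : Fin r) → suc (ℕΣ.sum (plusCoeff i j)) ℕ.+ (toℕ i ℕ.+ toℕ j) ≡ r ℕ.+ r
sum-plus {suc n} i j = begin
  suc (ℕΣ.sum (plusCoeff i j)) ℕ.+ (toℕ i ℕ.+ toℕ j)
    ≡⟨ cong (ℕ._+ (toℕ i ℕ.+ toℕ j)) (sum-adjustLast (plusCoeff i j) _ (plusCoeff-notLast i j)
         (λ k ¬p → trans (cong suc (plusCoeff-last i j k ¬p)) (sym (cong₂ ℕ._+_
           (𝟙-yes (i Fin.≤? k) (last≥ ¬p i)) (𝟙-yes (j Fin.≤? k) (last≥ ¬p j)))))) ⟩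
  ℕΣ.sum (λ (k : Fin (suc n)) → 𝟙 (i Fin.≤? k) ℕ.+ 𝟙 (j Fin.≤? k)) ℕ.+ (toℕ i ℕ.+ toℕ j)
    ≡⟨ cong (ℕ._+ (toℕ i ℕ.+ toℕ j)) (ℕΣ.∑-distrib-+ {suc n} (λ (k : Fin (suc n)) → 𝟙 (i Fin.≤? k)) (λ (k : Fin (suc n)) → 𝟙 (j Fin.≤? k))) ⟩
  S i ℕ.+ S j ℕ.+ (toℕ i ℕ.+ toℕ j)     ≡⟨ l (S i) (S j) (toℕ i) (toℕ j) ⟩
  (S i ℕ.+ toℕ i) ℕ.+ (S j ℕ.+ toℕ j)   ≡⟨ cong₂ ℕ._+_ (sum-𝟙 i) (sum-𝟙 j) ⟩
  suc n ℕ.+ suc n ∎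
  where
  open ≡-Reasoning
  S : Fin (suc n) → ℕ
  S i = ℕΣ.sum (λ (k : Fin (suc n)) → 𝟙 (i Fin.≤? k))
  l : ∀ a b c d → a ℕ.+ b ℕ.+ (c ℕ.+ d) ≡ (a ℕ.+ c) ℕ.+ (b ℕ.+ d)
  l = ℕSolver.solve-∀

tipHt : ∀ {r} → Fin r → Tip r → ℕ
tipHt i t = ℕΣ.sum (tipCoeff i t)

ht≡tipHt : ∀ {r} (α : PosRoot r) → ht α ≡ tipHt (lo α) (tip α)
ht≡tipHt α = cong ℕΣ.sum (coeff≡tipCoeff α)

ht-lowerLo : ∀ {n} (x : Fin n) t → Valid (suc x) t →
             tipHt (Fin.inject₁ x) t ≡ suc (tipHt (suc x) t)
ht-lowerLo x (inj₁ j) x+1<j = ℕₚ.+-cancelʳ-≡ (toℕ x) _ _ (begin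
  tipHt (Fin.inject₁ x) (inj₁ j) ℕ.+ toℕ x
    ≡⟨ cong (tipHt (Fin.inject₁ x) (inj₁ j) ℕ.+_) (Finₚ.toℕ-inject₁ x) ⟨
  tipHt (Fin.inject₁ x) (inj₁ j) ℕ.+ toℕ (Fin.inject₁ x)
    ≡⟨ sum-minus (Fin.inject₁ x) j
         (subst (ℕ._< toℕ j) (sym (Finₚ.toℕ-inject₁ x)) (ℕₚ.<-trans (ℕₚ.n<1+n _) x+1<j)) ⟩
  toℕ j                                        ≡⟨ sum-minus (suc x) j x+1<j ⟨
  tipHt (suc x) (inj₁ j) ℕ.+ suc (toℕ x)       ≡⟨ ℕₚ.+-suc _ (toℕ x) ⟩
  suc (tipHt (suc x) (inj₁ j)) ℕ.+ toℕ x       ∎)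
  where open ≡-Reasoning
ht-lowerLo x (inj₂ j) _ = ℕₚ.+-cancelʳ-≡ (toℕ x ℕ.+ toℕ j) _ _ (ℕₚ.suc-injective (begin
  suc (tipHt (Fin.inject₁ x) (inj₂ j)) ℕ.+ (toℕ x ℕ.+ toℕ j)
    ≡⟨ cong (λ y → suc (tipHt (Fin.inject₁ x) (inj₂ j)) ℕ.+ (y ℕ.+ toℕ j)) (Finₚ.toℕ-inject₁ x) ⟨
  suc (tipHt (Fin.inject₁ x) (inj₂ j)) ℕ.+ (toℕ (Fin.inject₁ x) ℕ.+ toℕ j)
    ≡⟨ trans (sum-plus (Fin.inject₁ x) j) (sym (sum-plus (suc x) j)) ⟩
  suc (tipHt (suc x) (inj₂ j)) ℕ.+ (suc (toℕ x) ℕ.+ toℕ j)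
    ≡⟨ ℕₚ.+-suc _ (toℕ x ℕ.+ toℕ j) ⟩
  suc (suc (tipHt (suc x) (inj₂ j))) ℕ.+ (toℕ x ℕ.+ toℕ j) ∎))
  where open ≡-Reasoning

-- A comparison that is not an equality passes through a root of height one more.
raise : ∀ {r} (i i′ : Fin r) s t → Valid i s → Valid i′ t → i′ Fin.≤ i → s ⊑ t →
        ¬ (i ≡ i′ × s ≡ t) →
        ∃ λ j → ∃ λ u → Valid j u × i′ Fin.≤ j × j Fin.≤ i × s ⊑ u × u ⊑ t × tipHt j u ≡ suc (tipHt i s)
raise i i′ s t vs vt i′≤i s⊑t ne with ℕₚ.m≤n⇒m<n∨m≡n i′≤i
raise (suc x) i′ s t vs vt _ s⊑t _ | inj₁ i′<i =
  Fin.inject₁ x , s , weaken s vs ,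
  subst (toℕ i′ ℕ.≤_) (sym (Finₚ.toℕ-inject₁ x)) (ℕ.s≤s⁻¹ i′<i) ,
  x≤ , ⊑-refl s , s⊑t , ht-lowerLo x s vs
  where
  x≤ : toℕ (Fin.inject₁ x) ℕ.≤ suc (toℕ x)
  x≤ = subst (ℕ._≤ suc (toℕ x)) (sym (Finₚ.toℕ-inject₁ x)) (ℕₚ.n≤1+n _)
  weaken : ∀ s → Valid (suc x) s → Valid (Fin.inject₁ x) s
  weaken (inj₁ _) v = ℕₚ.≤-<-trans x≤ v
  weaken (inj₂ _) v = ℕₚ.≤-trans x≤ v
raise i i′ s t vs vt _ s⊑t ne | inj₂ i′≡i with refl ← Finₚ.toℕ-injective i′≡i = go s t vs vt s⊑t (λ s≡t → ne (refl , s≡t))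
  where
  stepRight : ∀ j t → i Fin.< j → suc (toℕ j) ℕ.< _ →
              (∀ (j⁺ : Fin _) → toℕ j⁺ ≡ suc (toℕ j) → inj₁ j⁺ ⊑ t) →
              ∃ λ k → ∃ λ u → Valid k u × i Fin.≤ k × k Fin.≤ i × inj₁ j ⊑ u × u ⊑ t × tipHt k u ≡ suc (tipHt i (inj₁ j))
  stepRight j t i<j j+1<r u⊑ = i , inj₁ j⁺ , i<j⁺ , ℕₚ.≤-refl , ℕₚ.≤-refl ,
    subst (toℕ j ℕ.≤_) (sym eq) (ℕₚ.n≤1+n _) , u⊑ j⁺ eq ,
    ℕₚ.+-cancelʳ-≡ (toℕ i) _ _ (trans (sum-minus i j⁺ i<j⁺) (trans eq (cong suc (sym (sum-minus i j i<j)))))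
    where
    j⁺ = fromℕ< j+1<r
    eq : toℕ j⁺ ≡ suc (toℕ j)
    eq = Finₚ.toℕ-fromℕ< j+1<r
    i<j⁺ : i Fin.< j⁺
    i<j⁺ = subst (toℕ i ℕ.<_) (sym eq) (ℕₚ.<-trans i<j (ℕₚ.n<1+n _))
  go : ∀ s t → Valid i s → Valid i t → s ⊑ t → s ≢ t →
       ∃ λ j → ∃ λ u → Valid j u × i Fin.≤ j × j Fin.≤ i × s ⊑ u × u ⊑ t × tipHt j u ≡ suc (tipHt i s)
  go (inj₁ j) (inj₁ j′) vs vt j≤j′ ne with ℕₚ.m≤n⇒m<n∨m≡n j≤j′
  ... | inj₂ j≡j′ = contradiction (cong inj₁ (Finₚ.toℕ-injective j≡j′)) ne
  ... | inj₁ j<j′ = stepRight j (inj₁ j′) vs (ℕₚ.≤-<-trans j<j′ (Finₚ.toℕ<n j′))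
                      λ _ eq → subst (ℕ._≤ toℕ j′) (sym eq) j<j′
  go (inj₁ j) (inj₂ j′) vs vt _ _ with suc (toℕ j) ℕ.<? _
  ... | yes p = stepRight j (inj₂ j′) vs p _
  ... | no ¬p = i , inj₂ j , ℕₚ.<⇒≤ vs , ℕₚ.≤-refl , ℕₚ.≤-refl , _ , last≥ ¬p j′ ,
    trans (sym (ℕₚ.+-identityʳ _)) (l _ _ _ _ _ (sum-plus i j) (sum-minus i j vs)
      (ℕₚ.≤-antisym (Finₚ.toℕ<n j) (ℕₚ.≮⇒≥ ¬p)))
    where
    l : ∀ h h′ i j r → suc h′ ℕ.+ (i ℕ.+ j) ≡ r ℕ.+ r → h ℕ.+ i ≡ j → suc j ≡ r → h′ ℕ.+ 0 ≡ suc h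
    l h h′ i .(h ℕ.+ i) .(suc (h ℕ.+ i)) p refl refl =
      ℕₚ.+-cancelʳ-≡ (suc (i ℕ.+ (h ℕ.+ i))) _ _ (trans (l₁ h′ h i) (trans p (l₂ h i)))
      where
      l₁ : ∀ h′ h i → h′ ℕ.+ 0 ℕ.+ suc (i ℕ.+ (h ℕ.+ i)) ≡ suc h′ ℕ.+ (i ℕ.+ (h ℕ.+ i))
      l₁ = ℕSolver.solve-∀
      l₂ : ∀ h i → suc (h ℕ.+ i) ℕ.+ suc (h ℕ.+ i) ≡ suc h ℕ.+ suc (i ℕ.+ (h ℕ.+ i))
      l₂ = ℕSolver.solve-∀
  go (inj₂ j) (inj₂ j′) vs vt j′≤j ne with ℕₚ.m≤n⇒m<n∨m≡n j′≤j
  go (inj₂ j) (inj₂ j′) vs vt j′≤j ne | inj₂ j′≡j = contradiction (cong inj₂ (sym (Finₚ.toℕ-injective j′≡j))) ne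
  go (inj₂ (suc x)) (inj₂ j′) vs vt j′≤j ne | inj₁ j′<j =
    i , inj₂ (Fin.inject₁ x) , ℕₚ.≤-trans vt j′≤x , ℕₚ.≤-refl , ℕₚ.≤-refl ,
    subst (ℕ._≤ suc (toℕ x)) (sym eq) (ℕₚ.n≤1+n _) , j′≤x ,
    ℕₚ.+-cancelʳ-≡ (toℕ i ℕ.+ toℕ x) _ _ (ℕₚ.suc-injective
      (trans (cong (λ y → suc (tipHt i (inj₂ (Fin.inject₁ x))) ℕ.+ (toℕ i ℕ.+ y)) (sym eq))
      (trans (sum-plus i (Fin.inject₁ x))
      (trans (sym (sum-plus i (suc x))) (l (tipHt i (inj₂ (suc x))) (toℕ i) (toℕ x))))))
    where
    eq = Finₚ.toℕ-inject₁ x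
    j′≤x : toℕ j′ ℕ.≤ toℕ (Fin.inject₁ x)
    j′≤x = subst (toℕ j′ ℕ.≤_) (sym eq) (ℕ.s≤s⁻¹ j′<j)
    l : ∀ h i x → suc h ℕ.+ (i ℕ.+ suc x) ≡ suc (suc h) ℕ.+ (i ℕ.+ x)
    l = ℕSolver.solve-∀

1≤ht : ∀ {r} (α : PosRoot r) → 1 ℕ.≤ ht α
1≤ht α = subst (1 ℕ.≤_) (sym (ht≡tipHt α))
  (ℕₚ.≤-trans (1≤tipCoeff-lo (lo α) (tip α) (valid α)) (≤sum (tipCoeff (lo α) (tip α)) (lo α)))
  where
  ≤sum : ∀ {n} (f : Fin n → ℕ) k → f k ℕ.≤ ℕΣ.sum f
  ≤sum f zero    = ℕₚ.m≤m+n _ _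
  ≤sum f (suc k) = ℕₚ.≤-trans (≤sum (f ∘ suc) k) (ℕₚ.m≤n+m _ (f zero))

rk-suc : ∀ {r} (α β : PosRoot r) → ht β ≡ suc (ht α) → rk β ≡ suc (rk α)
rk-suc α β eq = trans (cong (ℕ._∸ 1) eq) (sym (ℕₚ.suc-pred (ht α) {{ℕ.>-nonZero (1≤ht α)}}))

rk-cover : ∀ {r} {α β : PosRoot r} → α ≼ β → α ≢ β →
           (∀ γ → ¬ ((α ≼ γ × α ≢ γ) × (γ ≼ β × γ ≢ β))) → rk β ≡ suc (rk α)
rk-cover {α = α} {β} α≼β α≢β gap =
  decidable-stable (rk β ℕ.≟ suc (rk α)) λ rk≢ →
    gap γ ((≼ᵉ⇒≼ {α = α} {γ} (subst (Fin._≤ lo α) (sym lo≡) j≤ , subst (tip α ⊑_) (sym tip≡) s⊑u) ,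
            λ α≡γ → ℕₚ.1+n≢n (trans (sym htγ) (cong ht (sym α≡γ)))) ,
           (≼ᵉ⇒≼ {α = γ} {β} (subst (lo β Fin.≤_) (sym lo≡) ≤j , subst (_⊑ tip β) (sym tip≡) u⊑t) ,
            λ γ≡β → rk≢ (rk-suc α β (trans (cong ht (sym γ≡β)) htγ))))
  where
  α≤β = ≼⇒≼ᵉ {α = α} {β} α≼β
  raised = raise (lo α) (lo β) (tip α) (tip β) (valid α) (valid β) (proj₁ α≤β) (proj₂ α≤β)
             λ (l , t) → α≢β (root-unique α β l t)
  j = proj₁ raised
  u = proj₁ (proj₂ raised)
  rest = proj₂ (proj₂ raised)
  ≤j = proj₁ (proj₂ rest)
  j≤ = proj₁ (proj₂ (proj₂ rest))
  s⊑u = proj₁ (proj₂ (proj₂ (proj₂ rest)))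
  u⊑t = proj₁ (proj₂ (proj₂ (proj₂ (proj₂ rest))))
  ht≡ = proj₂ (proj₂ (proj₂ (proj₂ (proj₂ rest))))
  made = root j u (proj₁ rest)
  γ = proj₁ made
  lo≡ = proj₁ (proj₂ made)
  tip≡ = proj₂ (proj₂ made)
  htγ : ht γ ≡ suc (ht α)
  htγ = trans (ht≡tipHt γ) (trans (cong₂ tipHt lo≡ tip≡) (trans ht≡ (cong suc (sym (ht≡tipHt α)))))

2e₀-maximum : ∀ {n} (α : PosRoot (suc n)) → α ≼ 2e⟨ zero ⟩
2e₀-maximum α = ≼ᵉ⇒≼ {α = α} {2e⟨ zero ⟩} (z≤n , tip⊑ (tip α))
  where
  tip⊑ : ∀ t → t ⊑ inj₂ zero
  tip⊑ (inj₁ _) = _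
  tip⊑ (inj₂ _) = z≤n

∈-mapMaybe : ∀ {A B : Set} (f : A → Maybe B) {x y xs} → x ∈ xs → f x ≡ just y → y ∈ mapMaybe f xs
∈-mapMaybe f (here {x} refl) eq with just _ ← f x | refl ← eq = here refl
∈-mapMaybe f (there {x} x∈) eq with f x
... | just _  = there (∈-mapMaybe f x∈ eq)
... | nothing = ∈-mapMaybe f x∈ eq

mapMaybe-All : ∀ {A B : Set} (f : A → Maybe B) {P : B → Set} {Q : A → Set} →
               (∀ x {y} → Q x → f x ≡ just y → P y) → ∀ {xs} → All Q xs → All P (mapMaybe f xs)
mapMaybe-All f g [] = []
mapMaybe-All f g (_∷_ {x} q qs) with f x in eq
... | just _  = g x q eq ∷ mapMaybe-All f g qs
... | nothing = mapMaybe-All f g qs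

mapMaybe-Unique : ∀ {A B : Set} (f : A → Maybe B) →
                  (∀ {x x′ y} → f x ≡ just y → f x′ ≡ just y → x ≡ x′) →
                  ∀ {xs} → Unique xs → Unique (mapMaybe f xs)
mapMaybe-Unique f inj [] = []
mapMaybe-Unique f inj (_∷_ {x} x∉ u) with f x in eq
... | nothing = mapMaybe-Unique f inj u
... | just y  = mapMaybe-All f (λ { x′ x≢x′ eq′ refl → x≢x′ (inj eq eq′) }) x∉ ∷ mapMaybe-Unique f inj u

minus?-just : ∀ {r} (i j : Fin r) p → minus? (i , j) ≡ just (e⟨ i ⟩-e⟨ j ⟩∣ p)
minus?-just i j p with i Fin.<? j
... | yes q = cong (λ p → just (e⟨ i ⟩-e⟨ j ⟩∣ p)) (ℕₚ.<-irrelevant q p)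
... | no ¬p = contradiction p ¬p

plus?-just : ∀ {r} (i j : Fin r) p → plus? (i , j) ≡ just (e⟨ i ⟩+e⟨ j ⟩∣ p)
plus?-just i j p with i Fin.<? j
... | yes q = cong (λ p → just (e⟨ i ⟩+e⟨ j ⟩∣ p)) (ℕₚ.<-irrelevant q p)
... | no ¬p = contradiction p ¬p

ends : ∀ {r} → PosRoot r → Fin r × Fin r
ends (e⟨ i ⟩-e⟨ j ⟩∣ _) = i , j
ends (e⟨ i ⟩+e⟨ j ⟩∣ _) = i , j
ends 2e⟨ i ⟩            = i , i

kind : ∀ {r} → PosRoot r → ℕ
kind (e⟨ _ ⟩-e⟨ _ ⟩∣ _) = 0
kind (e⟨ _ ⟩+e⟨ _ ⟩∣ _) = 1
kind 2e⟨ _ ⟩            = 2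

minus?-inv : ∀ {r} (x : Fin r × Fin r) {α} → minus? x ≡ just α → ends α ≡ x × kind α ≡ 0
minus?-inv (i , j) eq with yes _ ← i Fin.<? j | refl ← eq = refl , refl

plus?-inv : ∀ {r} (x : Fin r × Fin r) {α} → plus? x ≡ just α → ends α ≡ x × kind α ≡ 1
plus?-inv (i , j) eq with yes _ ← i Fin.<? j | refl ← eq = refl , refl

posRoots-complete : ∀ {r} (α : PosRoot r) → α ∈ posRoots r
posRoots-complete {r} (e⟨ i ⟩-e⟨ j ⟩∣ p) = ∈ₚ.∈-++⁺ˡ
  (∈-mapMaybe minus? (∈ₚ.∈-cartesianProduct⁺ (∈ₚ.∈-allFin i) (∈ₚ.∈-allFin j)) (minus?-just i j p))
posRoots-complete {r} (e⟨ i ⟩+e⟨ j ⟩∣ p) = ∈ₚ.∈-++⁺ʳ (mapMaybe minus? (pairs r)) (∈ₚ.∈-++⁺ˡ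
  (∈-mapMaybe plus? (∈ₚ.∈-cartesianProduct⁺ (∈ₚ.∈-allFin i) (∈ₚ.∈-allFin j)) (plus?-just i j p)))
posRoots-complete {r} 2e⟨ i ⟩ = ∈ₚ.∈-++⁺ʳ (mapMaybe minus? (pairs r))
  (∈ₚ.∈-++⁺ʳ (mapMaybe plus? (pairs r)) (∈ₚ.∈-map⁺ 2e⟨_⟩ (∈ₚ.∈-allFin i)))

posRoots-unique : ∀ r → Unique (posRoots r)
posRoots-unique r =
  Uniqueₚ.++⁺ (mapMaybe-Unique minus? (λ {x} {x′} p q → trans (sym (proj₁ (minus?-inv x p))) (proj₁ (minus?-inv x′ q))) pairs!)
    (Uniqueₚ.++⁺ (mapMaybe-Unique plus? (λ {x} {x′} p q → trans (sym (proj₁ (plus?-inv x p))) (proj₁ (plus?-inv x′ q))) pairs!)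
      (Uniqueₚ.map⁺ (λ { refl → refl }) (Uniqueₚ.allFin⁺ r))
      λ (p , q) → contradiction (trans (sym (All.lookup all₁ p)) (All.lookup all₂ q)) λ ())
    λ (p , q) → contradiction (All.lookup all₀ p) (ℕₚ.m<n⇒n≢0 (All.lookup all₁₂ q))
  where
  pairs! : Unique (pairs r)
  pairs! = Uniqueₚ.cartesianProduct⁺ (Uniqueₚ.allFin⁺ r) (Uniqueₚ.allFin⁺ r)
  all₀ : All (λ α → kind α ≡ 0) (mapMaybe minus? (pairs r))
  all₀ = mapMaybe-All minus? (λ x _ eq → proj₂ (minus?-inv x eq)) (All.universal (λ _ → tt) (pairs r))
  all₁ : All (λ α → kind α ≡ 1) (mapMaybe plus? (pairs r))
  all₁ = mapMaybe-All plus? (λ x _ eq → proj₂ (plus?-inv x eq)) (All.universal (λ _ → tt) (pairs r))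
  all₂ : All (λ α → kind α ≡ 2) (map 2e⟨_⟩ (allFin r))
  all₂ = Allₚ.map⁺ (All.universal (λ _ → refl) (allFin r))
  all₁₂ : All (λ α → 1 ℕ.≤ kind α) (mapMaybe plus? (pairs r) ++ map 2e⟨_⟩ (allFin r))
  all₁₂ = Allₚ.++⁺ (All.map (λ eq → ℕₚ.≤-reflexive (sym eq)) all₁)
                   (All.map (λ eq → subst (1 ℕ.≤_) (sym eq) (s≤s z≤n)) all₂)

Φ⁺C : ∀ r → .{{NonZero r}} → FiniteGradedPoset
Φ⁺C r@(suc _) = record
  { Carrier           = PosRoot r
  ; _≤_               = _≼_
  ; isDecPartialOrder = ≼-isDecPartialOrder r
  ; elements          = posRoots r
  ; complete          = posRoots-complete
  ; unique            = posRoots-unique r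
  ; top               = 2e⟨ zero ⟩
  ; maximum           = 2e₀-maximum
  ; ρ                 = rk
  ; ρ-cover           = λ {α} {β} ((α≼β , α≢β) , gap) → rk-cover {α = α} {β} α≼β α≢β gap
  }

{-# OPTIONS --safe #-}
-- Root posets of type C are triangles of lattice points (a , b), a ≤ b, a + b ≤ N = 2r - 2,
-- ranked by N - a - b and ordered by reversed componentwise order.  Let Z a b be the
-- series of weak chains in the ideal of (a , b).  Splitting off the top of a chain and
-- applying inclusion–exclusion to the ideal gives, with n = N - a - b,
--   (1 - qⁿ t) Z a b = Z (a + 1) b + Z a (b + 1) - Z (a + 1) (b + 1),
-- where Z (a + 1) a = Z (a + 1) (a + 1) at the boundary a = b.  A word read forwards is a
-- maximal chain, L decreasing a and R decreasing b; classifying the words that end in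
-- (a , b) by their last two letters gives the same recurrence for
-- Z a b · ∏_{c ≤ n} (1 - qᶜ t), the factor qⁿ⁻¹ t coming from an L after an R.
module Submission where

open import Defs
open import Data.Integer using (0ℤ; _≤_)
open import Data.Nat using (ℕ; NonZero)
open import Data.Product using (_×_)

open import Data.Bool.Base using (true; false; if_then_else_)
open import Data.Fin as Fin using (Fin; zero; suc; toℕ; fromℕ<)
import Data.Fin.Properties as Finₚ
open import Data.Integer as ℤ using (ℤ)
import Data.Integer.Properties as ℤₚ
open import Data.Integer.Tactic.RingSolver using (solve-∀)
open import Data.List.Base as List
  using (List; []; _∷_; _++_; map; foldr; filter; upTo; cartesianProductWith;
         inits; length; allFin; tabulate)
open import Data.List.Membership.Propositional using (_∈_)
import Data.List.Properties as Listₚ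
open import Data.List.Relation.Unary.All as All using (All; []; _∷_)
import Data.List.Relation.Unary.All.Properties as Allₚ
open import Data.List.Relation.Unary.AllPairs using ([]; _∷_)
open import Data.List.Relation.Unary.Any using (here; there)
open import Data.List.Relation.Unary.Unique.Propositional using (Unique)
open import Data.Nat as ℕ using (zero; suc; z≤n; s≤s)
open import Data.Nat.ListAction using (sum)
open import Data.Nat.ListAction.Properties using (sum-++)
import Data.Nat.Properties as ℕₚ
import Data.Nat.Tactic.RingSolver as ℕSolver
open import Data.Product using (∃; _,_; proj₁; proj₂)
open import Data.Sum.Base using (_⊎_; inj₁; inj₂)
open import Data.Vec.Base as Vec using (Vec; []; _∷_; _∷ʳ_; lookup; toList)
import Data.Vec.Properties as Vecₚ
open import Data.Vec.Relation.Unary.Linked using (Linked; linked?; []; [-]; _∷_)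
open import Function.Base using (_∘_; id)
open import Relation.Binary.Definitions using (tri<; tri≈; tri>)
open import Relation.Binary.PropositionalEquality
open import Relation.Binary.Structures using (IsDecPartialOrder)
open import Relation.Nullary using (¬_; Dec; yes; no; does; contradiction)
open import Relation.Nullary.Decidable using (_×-dec_)
import Algebra.Properties.CommutativeMonoid.Sum ℤₚ.+-0-commutativeMonoid as ℤΣ

-- Finite sums over lists

-- Keeping the condition in the summand lets sums over different subsets run over one common list,
-- so that they can be compared termwise.
when : ∀ {P : Set} → Dec P → ℤ → ℤ
when d z = if does d then z else 0ℤ

when-cong : ∀ {P Q : Set} (p : Dec P) (q : Dec Q) {x y} →
            (P → Q) → (Q → P) → x ≡ y → when p x ≡ when q y
when-cong (yes _) (yes _) _ _ x≡y = x≡y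
when-cong (no  _) (no  _) _ _ _   = refl
when-cong (yes p) (no ¬q) f _ _   = contradiction (f p) ¬q
when-cong (no ¬p) (yes q) _ g _   = contradiction (g q) ¬p

when-yes : ∀ {P : Set} (p : Dec P) {x} → P → when p x ≡ x
when-yes (yes _) _ = refl
when-yes (no ¬p) p = contradiction p ¬p

when-no : ∀ {P : Set} (p : Dec P) {x} → ¬ P → when p x ≡ 0ℤ
when-no (yes p) ¬p = contradiction p ¬p
when-no (no _)  _  = refl

when-0 : ∀ {P : Set} (p : Dec P) → when p 0ℤ ≡ 0ℤ
when-0 (yes _) = refl
when-0 (no  _) = refl

when-× : ∀ {P Q R : Set} (p : Dec P) (q : Dec Q) (r : Dec R) {x} →
         (R → P × Q) → (P → Q → R) → when r x ≡ when p (when q x)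
when-× (yes p) q r f g = when-cong r q (proj₂ ∘ f) (g p) refl
when-× (no ¬p) q r f g = when-no r (¬p ∘ proj₁ ∘ f)

total : ∀ {A : Set} → List A → (A → ℤ) → ℤ
total xs h = foldr ℤ._+_ 0ℤ (map h xs)

module _ {A : Set} where

  total-cong : ∀ (xs : List A) {h k : A → ℤ} → h ≗ k → total xs h ≡ total xs k
  total-cong xs h≗k = cong (foldr ℤ._+_ 0ℤ) (Listₚ.map-cong h≗k xs)

  total-0 : ∀ (xs : List A) → total xs (λ _ → 0ℤ) ≡ 0ℤ
  total-0 []       = refl
  total-0 (_ ∷ xs) = trans (ℤₚ.+-identityˡ _) (total-0 xs)

  total-+ : ∀ (xs : List A) h k → total xs (λ x → h x ℤ.+ k x) ≡ total xs h ℤ.+ total xs k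
  total-+ []       h k = refl
  total-+ (x ∷ xs) h k = trans (cong (ℤ._+_ (h x ℤ.+ k x)) (total-+ xs h k))
                               (l (h x) (k x) (total xs h) (total xs k))
    where
    l : ∀ a b c d → (a ℤ.+ b) ℤ.+ (c ℤ.+ d) ≡ (a ℤ.+ c) ℤ.+ (b ℤ.+ d)
    l = solve-∀

  total-- : ∀ (xs : List A) h k → total xs (λ x → h x ℤ.- k x) ≡ total xs h ℤ.- total xs k
  total-- []       h k = refl
  total-- (x ∷ xs) h k = trans (cong (ℤ._+_ (h x ℤ.- k x)) (total-- xs h k))
                               (l (h x) (k x) (total xs h) (total xs k))
    where
    l : ∀ a b c d → (a ℤ.- b) ℤ.+ (c ℤ.- d) ≡ (a ℤ.+ c) ℤ.- (b ℤ.+ d)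
    l = solve-∀

  total-++ : ∀ (xs ys : List A) h → total (xs ++ ys) h ≡ total xs h ℤ.+ total ys h
  total-++ []       ys h = sym (ℤₚ.+-identityˡ _)
  total-++ (x ∷ xs) ys h = trans (cong (ℤ._+_ (h x)) (total-++ xs ys h))
                                 (sym (ℤₚ.+-assoc (h x) _ _))

  total-filter : ∀ {P : A → Set} (P? : ∀ x → Dec (P x)) (xs : List A) h →
                 total (filter P? xs) h ≡ total xs (λ x → when (P? x) (h x))
  total-filter P? []       h = refl
  total-filter P? (x ∷ xs) h with does (P? x)
  ... | true  = cong (ℤ._+_ (h x)) (total-filter P? xs h)
  ... | false = trans (total-filter P? xs h) (sym (ℤₚ.+-identityˡ _))

  total-when : ∀ {P : Set} (p : Dec P) (xs : List A) h →
               when p (total xs h) ≡ total xs (λ x → when p (h x))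
  total-when (yes _) xs h = refl
  total-when (no  _) xs h = sym (total-0 xs)

  total-nonneg : ∀ (xs : List A) h → (∀ x → 0ℤ ≤ h x) → 0ℤ ≤ total xs h
  total-nonneg []       h 0≤h = ℤₚ.≤-refl
  total-nonneg (x ∷ xs) h 0≤h = ℤₚ.+-mono-≤ (0≤h x) (total-nonneg xs h 0≤h)

total-zero : ∀ {A : Set} {xs : List A} {h} → All (λ x → h x ≡ 0ℤ) xs → total xs h ≡ 0ℤ
total-zero []       = refl
total-zero (p ∷ ps) = cong₂ ℤ._+_ p (total-zero ps)

total-point : ∀ {A : Set} {xs : List A} {x} h → Unique xs → x ∈ xs →
              (∀ z → z ≢ x → h z ≡ 0ℤ) → total xs h ≡ h x
total-point h (x∉ ∷ _) (here refl) off = trans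
  (cong (ℤ._+_ (h _)) (total-zero (All.map (λ {z} x≢z → off z (x≢z ∘ sym)) x∉)))
  (ℤₚ.+-identityʳ _)
total-point h (y∉ ∷ u) (there x∈) off = trans
  (cong₂ ℤ._+_ (off _ (All.lookup y∉ x∈)) (total-point h u x∈ off))
  (ℤₚ.+-identityˡ _)

total-map : ∀ {A B : Set} (f : A → B) xs h → total (map f xs) h ≡ total xs (h ∘ f)
total-map f xs h = cong (foldr ℤ._+_ 0ℤ) (sym (Listₚ.map-∘ xs))

total-swap : ∀ {A B : Set} (xs : List A) (ys : List B) (h : A → B → ℤ) →
             total xs (λ x → total ys (h x)) ≡ total ys (λ y → total xs (λ x → h x y))
total-swap []       ys h = sym (total-0 ys)
total-swap (x ∷ xs) ys h = trans (cong (ℤ._+_ (total ys (h x))) (total-swap xs ys h))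
  (sym (total-+ ys (h x) (λ y → total xs (λ x → h x y))))

total-cartesianProductWith :
  ∀ {A B C : Set} (f : A → B → C) xs ys h →
  total (cartesianProductWith f xs ys) h ≡ total xs (λ x → total ys (λ y → h (f x y)))
total-cartesianProductWith f []       ys h = refl
total-cartesianProductWith f (x ∷ xs) ys h = trans (total-++ (map (f x) ys) _ h)
  (cong₂ ℤ._+_ (total-map (f x) ys h) (total-cartesianProductWith f xs ys h))

-- `tuples` grows vectors at the front, but chains are split at their top and words at their last
-- letters, so sums have to be peeled at the other end.
total-tuples-∷ʳ : ∀ {A : Set} (xs : List A) m h →
  total (tuples xs (suc m)) h ≡ total (tuples xs m) (λ v → total xs (λ x → h (v ∷ʳ x)))
total-tuples-∷ʳ xs zero h = begin
  total (tuples xs 1) h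
    ≡⟨ total-cartesianProductWith Vec._∷_ xs ([] ∷ []) h ⟩
  total xs (λ x → h (x ∷ []) ℤ.+ 0ℤ)
    ≡⟨ total-cong xs (λ x → ℤₚ.+-identityʳ _) ⟩
  total xs (λ x → h (x ∷ []))
    ≡⟨ ℤₚ.+-identityʳ _ ⟨
  total xs (λ x → h (x ∷ [])) ℤ.+ 0ℤ ∎
  where open ≡-Reasoning
total-tuples-∷ʳ xs (suc m) h = begin
  total (tuples xs (2 ℕ.+ m)) h
    ≡⟨ total-cartesianProductWith Vec._∷_ xs (tuples xs (suc m)) h ⟩
  total xs (λ x → total (tuples xs (suc m)) (λ v → h (x ∷ v)))
    ≡⟨ total-cong xs (λ x → total-tuples-∷ʳ xs m (λ v → h (x ∷ v))) ⟩
  total xs (λ x → total (tuples xs m) (λ v → total xs (λ y → h (x ∷ (v ∷ʳ y)))))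
    ≡⟨ total-cartesianProductWith Vec._∷_ xs (tuples xs m) _ ⟨
  total (tuples xs (suc m)) (λ v → total xs (λ x → h (v ∷ʳ x))) ∎
  where open ≡-Reasoning

-- Multiplication by powers of q and t

shiftq : ℕ → Series → Series
shiftq zero    F i       n = F i n
shiftq (suc c) F zero    n = 0ℤ
shiftq (suc c) F (suc i) n = shiftq c F i n

shiftt : Series → Series
shiftt F i zero    = 0ℤ
shiftt F i (suc n) = F i n

-- Multiplication by qᶜ t done by moving indices, so that coefficients compute; `q^t-⊛` identifies
-- it with the Cauchy product.
shift : ℕ → Series → Series
shift c F = shiftt (shiftq c F)

-- Multiplication by 1 - qᶜ t.
Δ : ℕ → Series → Series
Δ c F = F ⊖ shift c F

𝟏 : Series
𝟏 = q^ 0 t^ 0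

≈-trans : ∀ {F G H} → F ≈ G → G ≈ H → F ≈ H
≈-trans p q i n = trans (p i n) (q i n)

⊖-cong : ∀ {F F′ G G′} → F ≈ F′ → G ≈ G′ → F ⊖ G ≈ F′ ⊖ G′
⊖-cong p q i n = cong₂ ℤ._-_ (p i n) (q i n)

shiftq-cong : ∀ c {F G} → F ≈ G → shiftq c F ≈ shiftq c G
shiftq-cong zero    p i       n = p i n
shiftq-cong (suc c) p zero    n = refl
shiftq-cong (suc c) p (suc i) n = shiftq-cong c p i n

shiftt-cong : ∀ {F G} → F ≈ G → shiftt F ≈ shiftt G
shiftt-cong p i zero    = refl
shiftt-cong p i (suc n) = p i n

shift-cong : ∀ c {F G} → F ≈ G → shift c F ≈ shift c G
shift-cong c p = shiftt-cong (shiftq-cong c p)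

shiftq-⊖ : ∀ c F G → shiftq c (F ⊖ G) ≈ shiftq c F ⊖ shiftq c G
shiftq-⊖ zero    F G i       n = refl
shiftq-⊖ (suc c) F G zero    n = refl
shiftq-⊖ (suc c) F G (suc i) n = shiftq-⊖ c F G i n

shift-⊖ : ∀ c F G → shift c (F ⊖ G) ≈ shift c F ⊖ shift c G
shift-⊖ c F G i zero    = refl
shift-⊖ c F G i (suc n) = shiftq-⊖ c F G i n

shiftq-0 : ∀ c → shiftq c (λ _ _ → 0ℤ) ≈ λ _ _ → 0ℤ
shiftq-0 zero    i       n = refl
shiftq-0 (suc c) zero    n = refl
shiftq-0 (suc c) (suc i) n = shiftq-0 c i n

shiftq-∑ : ∀ {A : Set} c (xs : List A) f → shiftq c (∑ xs f) ≈ ∑ xs (shiftq c ∘ f)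
shiftq-∑ zero    xs f i       n = refl
shiftq-∑ (suc c) xs f zero    n = sym (total-0 xs)
shiftq-∑ (suc c) xs f (suc i) n = shiftq-∑ c xs f i n

shiftq-when : ∀ {P : Set} c (p : Dec P) F →
              shiftq c (λ i n → when p (F i n)) ≈ λ i n → when p (shiftq c F i n)
shiftq-when c (yes _) F i n = refl
shiftq-when c (no  _) F i n = shiftq-0 c i n

shift-when : ∀ {P : Set} c (p : Dec P) F → shift c (λ i n → when p (F i n)) ≈ λ i n → when p (shift c F i n)
shift-when c p F i zero    = sym (when-0 p)
shift-when c p F i (suc n) = shiftq-when c p F i n

shift-∑ : ∀ {A : Set} c (xs : List A) f → shift c (∑ xs f) ≈ ∑ xs (shift c ∘ f)
shift-∑ c xs f i zero    = sym (total-0 xs)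
shift-∑ c xs f i (suc n) = shiftq-∑ c xs f i n

shiftq-+ : ∀ b c F → shiftq b (shiftq c F) ≈ shiftq (b ℕ.+ c) F
shiftq-+ zero    c F i       n = refl
shiftq-+ (suc b) c F zero    n = refl
shiftq-+ (suc b) c F (suc i) n = shiftq-+ b c F i n

shiftq-comm : ∀ b c F → shiftq b (shiftq c F) ≈ shiftq c (shiftq b F)
shiftq-comm b c F i n = begin
  shiftq b (shiftq c F) i n ≡⟨ shiftq-+ b c F i n ⟩
  shiftq (b ℕ.+ c) F i n    ≡⟨ cong (λ d → shiftq d F i n) (ℕₚ.+-comm b c) ⟩
  shiftq (c ℕ.+ b) F i n    ≡⟨ shiftq-+ c b F i n ⟨
  shiftq c (shiftq b F) i n ∎
  where open ≡-Reasoning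

shiftq-shiftt : ∀ c F → shiftq c (shiftt F) ≈ shiftt (shiftq c F)
shiftq-shiftt zero    F i       n       = refl
shiftq-shiftt (suc c) F zero    zero    = refl
shiftq-shiftt (suc c) F zero    (suc n) = refl
shiftq-shiftt (suc c) F (suc i) zero    = shiftq-shiftt c F i zero
shiftq-shiftt (suc c) F (suc i) (suc n) = shiftq-shiftt c F i (suc n)

shift-comm : ∀ b c F → shift b (shift c F) ≈ shift c (shift b F)
shift-comm b c F i zero    = refl
shift-comm b c F i (suc n) = begin
  shiftq b (shiftt (shiftq c F)) i n ≡⟨ shiftq-shiftt b (shiftq c F) i n ⟩
  shiftt (shiftq b (shiftq c F)) i n ≡⟨ shiftt-cong (shiftq-comm b c F) i n ⟩
  shiftt (shiftq c (shiftq b F)) i n ≡⟨ shiftq-shiftt c (shiftq b F) i n ⟨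
  shiftq c (shiftt (shiftq b F)) i n ∎
  where open ≡-Reasoning

Δ-cong : ∀ c {F G} → F ≈ G → Δ c F ≈ Δ c G
Δ-cong c p = ⊖-cong p (shift-cong c p)

Δ-⊖ : ∀ c F G → Δ c (F ⊖ G) ≈ Δ c F ⊖ Δ c G
Δ-⊖ c F G i n = trans (cong (ℤ._-_ (F i n ℤ.- G i n)) (shift-⊖ c F G i n))
                      (l (F i n) (G i n) (shift c F i n) (shift c G i n))
  where
  l : ∀ a b c d → (a ℤ.- b) ℤ.- (c ℤ.- d) ≡ (a ℤ.- c) ℤ.- (b ℤ.- d)
  l = solve-∀

Δ-comm : ∀ b c F → Δ b (Δ c F) ≈ Δ c (Δ b F)
Δ-comm b c F i n = begin
  F i n ℤ.- shift c F i n ℤ.- shift b (F ⊖ shift c F) i n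
    ≡⟨ cong (ℤ._-_ (F i n ℤ.- shift c F i n)) (trans (shift-⊖ b F (shift c F) i n)
         (cong (ℤ._-_ (shift b F i n)) (shift-comm b c F i n))) ⟩
  F i n ℤ.- shift c F i n ℤ.- (shift b F i n ℤ.- shift c (shift b F) i n)
    ≡⟨ l (F i n) (shift c F i n) (shift b F i n) (shift c (shift b F) i n) ⟩
  F i n ℤ.- shift b F i n ℤ.- (shift c F i n ℤ.- shift c (shift b F) i n)
    ≡⟨ cong (ℤ._-_ (F i n ℤ.- shift b F i n)) (shift-⊖ c F (shift b F) i n) ⟨
  F i n ℤ.- shift b F i n ℤ.- shift c (F ⊖ shift b F) i n ∎
  where
  open ≡-Reasoning
  l : ∀ a b c d → (a ℤ.- b) ℤ.- (c ℤ.- d) ≡ (a ℤ.- c) ℤ.- (b ℤ.- d)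
  l = solve-∀

-- Products of factors 1 - qᶜ t

Δs : List ℕ → Series → Series
Δs cs F = foldr Δ F cs

Δs-cong : ∀ cs {F G} → F ≈ G → Δs cs F ≈ Δs cs G
Δs-cong []       p = p
Δs-cong (c ∷ cs) p = Δ-cong c (Δs-cong cs p)

Δs-⊖ : ∀ cs F G → Δs cs (F ⊖ G) ≈ Δs cs F ⊖ Δs cs G
Δs-⊖ []       F G i n = refl
Δs-⊖ (c ∷ cs) F G = ≈-trans (Δ-cong c (Δs-⊖ cs F G)) (Δ-⊖ c (Δs cs F) (Δs cs G))

Δs-Δ : ∀ cs c F → Δs cs (Δ c F) ≈ Δ c (Δs cs F)
Δs-Δ []       c F i n = refl
Δs-Δ (b ∷ cs) c F = ≈-trans (Δ-cong b (Δs-Δ cs c F)) (Δ-comm b c (Δs cs F))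

-- `upTo` grows at its end, so the new factor acts first, directly on `F`. For `Z a b` this is the
-- factor that `Z-step` absorbs.
Δs-upTo-suc : ∀ n F → Δs (upTo (suc n)) F ≡ Δs (upTo n) (Δ n F)
Δs-upTo-suc n F = trans (cong (foldr Δ F) (sym (Listₚ.upTo-∷ʳ n))) (Listₚ.foldr-∷ʳ Δ F n (upTo n))

-- Cauchy products

-- `(F ⊛ G) i n` unfolds to an `antidiagonal` for q whose entries are antidiagonals for t, so both
-- variables share the lemmas below.
antidiagonal : (ℕ → ℕ → ℤ) → ℕ → ℤ
antidiagonal h i = ℤΣ.sum λ (a : Fin (suc i)) → h (toℕ a) (i ℕ.∸ toℕ a)

antidiagonal-cong : ∀ {h k : ℕ → ℕ → ℤ} → (∀ a b → h a b ≡ k a b) →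
                    antidiagonal h ≗ antidiagonal k
antidiagonal-cong p i = ℤΣ.sum-cong-≗ {suc i} λ a → p (toℕ a) (i ℕ.∸ toℕ a)

antidiagonal-0 : ∀ i → antidiagonal (λ _ _ → 0ℤ) i ≡ 0ℤ
antidiagonal-0 i = ℤΣ.sum-replicate-zero (suc i)

antidiagonal-- : ∀ h k i → antidiagonal (λ a b → h a b ℤ.- k a b) i ≡
                           antidiagonal h i ℤ.- antidiagonal k i
antidiagonal-- h k zero    = l (h 0 0) (k 0 0)
  where
  l : ∀ x y → x ℤ.- y ℤ.+ 0ℤ ≡ (x ℤ.+ 0ℤ) ℤ.- (y ℤ.+ 0ℤ)
  l = solve-∀
antidiagonal-- h k (suc i) =
  trans (cong (ℤ._+_ (h 0 (suc i) ℤ.- k 0 (suc i))) (antidiagonal-- (h ∘ suc) (k ∘ suc) i))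
        (l (h 0 (suc i)) (k 0 (suc i)) (antidiagonal (h ∘ suc) i) (antidiagonal (k ∘ suc) i))
  where
  l : ∀ a b c d → (a ℤ.- b) ℤ.+ (c ℤ.- d) ≡ (a ℤ.+ c) ℤ.- (b ℤ.+ d)
  l = solve-∀

-- Only the first term splits off by computation. The last one, where the second index is 0, is the
-- term that a shift of the second factor turns into zero.
antidiagonal-last : ∀ h i → antidiagonal h (suc i) ≡
                            antidiagonal (λ a b → h a (suc b)) i ℤ.+ h (suc i) 0
antidiagonal-last h zero    = l (h 0 1) (h 1 0)
  where
  l : ∀ x y → x ℤ.+ (y ℤ.+ 0ℤ) ≡ x ℤ.+ 0ℤ ℤ.+ y
  l = solve-∀
antidiagonal-last h (suc i) =
  trans (cong (ℤ._+_ (h 0 (suc (suc i)))) (antidiagonal-last (h ∘ suc) i))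
        (sym (ℤₚ.+-assoc (h 0 (suc (suc i))) _ _))

⊛-shiftq : ∀ c F G → F ⊛ shiftq c G ≈ shiftq c (F ⊛ G)
⊛-shiftq zero    F G i       n = refl
⊛-shiftq (suc c) F G zero    n = trans (ℤₚ.+-identityʳ _)
  (trans (antidiagonal-cong {k = λ _ _ → 0ℤ} (λ b b′ → ℤₚ.*-zeroʳ (F 0 b)) n) (antidiagonal-0 n))
⊛-shiftq (suc c) F G (suc i) n = begin
  (F ⊛ shiftq (suc c) G) (suc i) n
    ≡⟨ antidiagonal-last (λ a a′ → antidiagonal (λ b b′ → F a b ℤ.* shiftq (suc c) G a′ b′) n) i ⟩
  (F ⊛ shiftq c G) i n ℤ.+ antidiagonal (λ b b′ → F (suc i) b ℤ.* 0ℤ) n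
    ≡⟨ cong₂ ℤ._+_ (⊛-shiftq c F G i n)
         (trans (antidiagonal-cong {k = λ _ _ → 0ℤ} (λ b b′ → ℤₚ.*-zeroʳ (F (suc i) b)) n)
                (antidiagonal-0 n)) ⟩
  shiftq c (F ⊛ G) i n ℤ.+ 0ℤ
    ≡⟨ ℤₚ.+-identityʳ _ ⟩
  shiftq c (F ⊛ G) i n ∎
  where open ≡-Reasoning

⊛-shiftt : ∀ F G → F ⊛ shiftt G ≈ shiftt (F ⊛ G)
⊛-shiftt F G i zero    = trans
  (antidiagonal-cong {k = λ _ _ → 0ℤ}
    (λ a a′ → trans (ℤₚ.+-identityʳ _) (ℤₚ.*-zeroʳ (F a 0))) i)
  (antidiagonal-0 i)
⊛-shiftt F G i (suc n) = antidiagonal-cong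
  {k = λ a a′ → antidiagonal (λ b b′ → F a b ℤ.* G a′ b′) n} (λ a a′ → trans
  (antidiagonal-last (λ b b′ → F a b ℤ.* shiftt G a′ b′) n)
  (trans (cong (ℤ._+_ (antidiagonal (λ b b′ → F a b ℤ.* G a′ b′) n)) (ℤₚ.*-zeroʳ (F a (suc n))))
         (ℤₚ.+-identityʳ _))) i

⊛-congˡ : ∀ F {G H} → G ≈ H → F ⊛ G ≈ F ⊛ H
⊛-congˡ F {G} {H} p i n = antidiagonal-cong
  {h = λ a a′ → antidiagonal (λ b b′ → F a b ℤ.* G a′ b′) n}
  {k = λ a a′ → antidiagonal (λ b b′ → F a b ℤ.* H a′ b′) n} (λ a a′ →
  antidiagonal-cong {h = λ b b′ → F a b ℤ.* G a′ b′} {k = λ b b′ → F a b ℤ.* H a′ b′} (λ b b′ → cong (ℤ._*_ (F a b)) (p a′ b′)) n) i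

⊛-⊖ : ∀ F G H → F ⊛ (G ⊖ H) ≈ F ⊛ G ⊖ F ⊛ H
⊛-⊖ F G H i n = trans
  (antidiagonal-cong (λ a a′ → trans
    (antidiagonal-cong (λ b b′ → l (F a b) (G a′ b′) (H a′ b′)) n)
    (antidiagonal-- (λ b b′ → F a b ℤ.* G a′ b′) (λ b b′ → F a b ℤ.* H a′ b′) n)) i)
  (antidiagonal-- (λ a a′ → antidiagonal (λ b b′ → F a b ℤ.* G a′ b′) n)
                  (λ a a′ → antidiagonal (λ b b′ → F a b ℤ.* H a′ b′) n) i)
  where
  l : ∀ x y z → x ℤ.* (y ℤ.- z) ≡ x ℤ.* y ℤ.- x ℤ.* z
  l = solve-∀

⊛-Δ : ∀ c F G → F ⊛ Δ c G ≈ Δ c (F ⊛ G)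
⊛-Δ c F G i n = begin
  (F ⊛ (G ⊖ shift c G)) i n
    ≡⟨ ⊛-⊖ F G (shift c G) i n ⟩
  (F ⊛ G) i n ℤ.- (F ⊛ shift c G) i n
    ≡⟨ cong (ℤ._-_ ((F ⊛ G) i n)) (⊛-shiftt F (shiftq c G) i n) ⟩
  (F ⊛ G) i n ℤ.- shiftt (F ⊛ shiftq c G) i n
    ≡⟨ cong (ℤ._-_ ((F ⊛ G) i n)) (shiftt-cong (⊛-shiftq c F G) i n) ⟩
  (F ⊛ G) i n ℤ.- shift c (F ⊛ G) i n ∎
  where open ≡-Reasoning

antidiagonal-head : ∀ h i → (∀ a b → h (suc a) b ≡ 0ℤ) → antidiagonal h i ≡ h 0 i
antidiagonal-head h zero    p = ℤₚ.+-identityʳ _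
antidiagonal-head h (suc i) p = trans
  (cong (ℤ._+_ (h 0 (suc i))) (trans (antidiagonal-cong p i) (antidiagonal-0 i)))
  (ℤₚ.+-identityʳ _)

𝟏-⊛ : ∀ G → 𝟏 ⊛ G ≈ G
𝟏-⊛ G i n = trans
  (antidiagonal-head (λ a a′ → antidiagonal (λ b b′ → 𝟏 a b ℤ.* G a′ b′) n) i
    (λ a a′ → antidiagonal-0 n))
  (trans (antidiagonal-head (λ b b′ → 𝟏 0 b ℤ.* G i b′) n (λ b b′ → refl))
         (ℤₚ.*-identityˡ (G i n)))

q^t-⊛ : ∀ c G → (q^ c t^ 1) ⊛ G ≈ shift c G
q^t-⊛ zero    G i       n = trans
  (antidiagonal-head (λ a a′ → antidiagonal (λ b b′ → (q^ 0 t^ 1) a b ℤ.* G a′ b′) n) i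
    (λ a a′ → antidiagonal-0 n))
  (row n)
  where
  row : ∀ n → antidiagonal (λ b b′ → (q^ 0 t^ 1) 0 b ℤ.* G i b′) n ≡ shiftt G i n
  row zero    = refl
  row (suc n) = trans (ℤₚ.+-identityˡ _)
    (trans (antidiagonal-head (λ b b′ → 𝟏 0 b ℤ.* G i b′) n (λ b b′ → refl)) (ℤₚ.*-identityˡ (G i n)))
q^t-⊛ (suc c) G zero    n = trans (trans (ℤₚ.+-identityʳ _) (antidiagonal-0 n)) (zero-row n)
  where
  zero-row : ∀ n → 0ℤ ≡ shift (suc c) G zero n
  zero-row zero    = refl
  zero-row (suc n) = refl
q^t-⊛ (suc c) G (suc i) n = trans
  (cong₂ ℤ._+_ (antidiagonal-0 n) (q^t-⊛ c G i n))
  (trans (ℤₚ.+-identityˡ _) (next-row n))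
  where
  next-row : ∀ n → shift c G i n ≡ shift (suc c) G (suc i) n
  next-row zero    = refl
  next-row (suc n) = refl

⊖-⊛ : ∀ F G H → (F ⊖ G) ⊛ H ≈ F ⊛ H ⊖ G ⊛ H
⊖-⊛ F G H i n = trans
  (antidiagonal-cong (λ a a′ → trans
    (antidiagonal-cong (λ b b′ → l (F a b) (G a b) (H a′ b′)) n)
    (antidiagonal-- (λ b b′ → F a b ℤ.* H a′ b′) (λ b b′ → G a b ℤ.* H a′ b′) n)) i)
  (antidiagonal-- (λ a a′ → antidiagonal (λ b b′ → F a b ℤ.* H a′ b′) n)
                  (λ a a′ → antidiagonal (λ b b′ → G a b ℤ.* H a′ b′) n) i)
  where
  l : ∀ x y z → (x ℤ.- y) ℤ.* z ≡ x ℤ.* z ℤ.- y ℤ.* z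
  l = solve-∀

⊛-𝟏 : ∀ F → F ⊛ 𝟏 ≈ F
⊛-𝟏 F i n = trans
  (antidiagonal-tail (λ a a′ → antidiagonal (λ b b′ → F a b ℤ.* 𝟏 a′ b′) n) i λ a a′ →
    trans (antidiagonal-cong {k = λ _ _ → 0ℤ} (λ b b′ → ℤₚ.*-zeroʳ (F a b)) n) (antidiagonal-0 n))
  (trans (antidiagonal-tail (λ b b′ → F i b ℤ.* 𝟏 0 b′) n (λ b b′ → ℤₚ.*-zeroʳ (F i b)))
         (ℤₚ.*-identityʳ (F i n)))
  where
  antidiagonal-tail : ∀ h i → (∀ a b → h a (suc b) ≡ 0ℤ) → antidiagonal h i ≡ h i 0
  antidiagonal-tail h zero    p = ℤₚ.+-identityʳ _
  antidiagonal-tail h (suc i) p = trans (antidiagonal-last h i) (trans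
    (cong (ℤ._+ h (suc i) 0) (trans (antidiagonal-cong p i) (antidiagonal-0 i)))
    (ℤₚ.+-identityˡ _))

-- Each factor becomes a `Δ c` on the right of `⊛` and is moved out by `⊛-Δ`, which avoids
-- associativity and commutativity of `⊛`.
⊛-∏ : ∀ F cs → F ⊛ ∏ cs (λ c → 𝟏 ⊖ (q^ c t^ 1)) ≈ Δs cs F
⊛-∏ F []       = ⊛-𝟏 F
⊛-∏ F (c ∷ cs) i n = begin
  (F ⊛ ((𝟏 ⊖ (q^ c t^ 1)) ⊛ G)) i n
    ≡⟨ ⊛-congˡ F (λ j m → trans (⊖-⊛ 𝟏 (q^ c t^ 1) G j m)
         (cong₂ ℤ._-_ (𝟏-⊛ G j m) (q^t-⊛ c G j m))) i n ⟩
  (F ⊛ Δ c G) i n       ≡⟨ ⊛-Δ c F G i n ⟩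
  Δ c (F ⊛ G) i n       ≡⟨ Δ-cong c (⊛-∏ F cs) i n ⟩
  Δ c (Δs cs F) i n     ∎
  where
  open ≡-Reasoning
  G = ∏ cs (λ c → 𝟏 ⊖ (q^ c t^ 1))

-- Words

-- The ballot condition as a walk: a and b are the numbers of L's and R's read so far, that is, the
-- coordinates of the current lattice point, and every point visited satisfies a ≤ b.
Bal : ℕ → ℕ → List Letter → Set
Bal a b []      = a ℕ.≤ b
Bal a b (L ∷ v) = a ℕ.≤ b × Bal (suc a) b v
Bal a b (R ∷ v) = a ℕ.≤ b × Bal a (suc b) v

bal? : ∀ a b v → Dec (Bal a b v)
bal? a b []      = a ℕ.≤? b
bal? a b (L ∷ v) = (a ℕ.≤? b) ×-dec bal? (suc a) b v
bal? a b (R ∷ v) = (a ℕ.≤? b) ×-dec bal? a (suc b) v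

-- The initial counts make induction on the word possible; with both equal to 0 this is `Ballot` by
-- computation.
BallotFrom : ℕ → ℕ → List Letter → Set
BallotFrom a b v = All (λ p → a ℕ.+ # L p ℕ.≤ b ℕ.+ # R p) (inits v)

ballotFrom⇒bal : ∀ a b v → BallotFrom a b v → Bal a b v
ballotFrom⇒bal a b []      (p ∷ [])  = subst₂ ℕ._≤_ (ℕₚ.+-identityʳ a) (ℕₚ.+-identityʳ b) p
ballotFrom⇒bal a b (L ∷ v) (p ∷ ps) =
  subst₂ ℕ._≤_ (ℕₚ.+-identityʳ a) (ℕₚ.+-identityʳ b) p ,
  ballotFrom⇒bal (suc a) b v (All.map (λ {w} → subst (ℕ._≤ b ℕ.+ # R w) (ℕₚ.+-suc a (# L w)))
    (Allₚ.map⁻ {xs = inits v} ps))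
ballotFrom⇒bal a b (R ∷ v) (p ∷ ps) =
  subst₂ ℕ._≤_ (ℕₚ.+-identityʳ a) (ℕₚ.+-identityʳ b) p ,
  ballotFrom⇒bal a (suc b) v (All.map (λ {w} → subst (a ℕ.+ # L w ℕ.≤_) (ℕₚ.+-suc b (# R w)))
    (Allₚ.map⁻ {xs = inits v} ps))

bal⇒ballotFrom : ∀ a b v → Bal a b v → BallotFrom a b v
bal⇒ballotFrom a b []      p        =
  subst₂ ℕ._≤_ (sym (ℕₚ.+-identityʳ a)) (sym (ℕₚ.+-identityʳ b)) p ∷ []
bal⇒ballotFrom a b (L ∷ v) (p , ps) =
  subst₂ ℕ._≤_ (sym (ℕₚ.+-identityʳ a)) (sym (ℕₚ.+-identityʳ b)) p ∷
  Allₚ.map⁺ {xs = inits v} (All.map (λ {w} → subst (ℕ._≤ b ℕ.+ # R w) (sym (ℕₚ.+-suc a (# L w))))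
    (bal⇒ballotFrom (suc a) b v ps))
bal⇒ballotFrom a b (R ∷ v) (p , ps) =
  subst₂ ℕ._≤_ (sym (ℕₚ.+-identityʳ a)) (sym (ℕₚ.+-identityʳ b)) p ∷
  Allₚ.map⁺ {xs = inits v} (All.map (λ {w} → subst (a ℕ.+ # L w ℕ.≤_) (sym (ℕₚ.+-suc b (# R w))))
    (bal⇒ballotFrom a (suc b) v ps))

backwards : ∀ {n} → Word n → List Letter
backwards w = List.reverse (toList w)

backwards-∷ʳ : ∀ {n} (w : Word n) c →
                    backwards (w ∷ʳ c) ≡ c ∷ backwards w
backwards-∷ʳ w c = trans (cong List.reverse (Vecₚ.toList-∷ʳ c w))
                              (Listₚ.reverse-++ (toList w) (c ∷ []))

-- The position set and weight of a word with a letter appended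

allFin-∷ʳ : ∀ n → allFin (suc n) ≡ map Fin.inject₁ (allFin n) ++ Fin.fromℕ n ∷ []
allFin-∷ʳ n = trans (tabulate-∷ʳ n id) (cong (_++ Fin.fromℕ n ∷ []) (sym (Listₚ.map-tabulate id Fin.inject₁)))
  where
  tabulate-∷ʳ : ∀ {A : Set} n (f : Fin (suc n) → A) →
                tabulate f ≡ tabulate (f ∘ Fin.inject₁) ++ f (Fin.fromℕ n) ∷ []
  tabulate-∷ʳ zero    f = refl
  tabulate-∷ʳ (suc n) f = cong (f zero ∷_) (tabulate-∷ʳ n (f ∘ suc))

filter-map : ∀ {A B : Set} {P : B → Set} (P? : ∀ y → Dec (P y)) (f : A → B) xs →
             filter P? (map f xs) ≡ map f (filter (P? ∘ f) xs)
filter-map P? f []       = refl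
filter-map P? f (x ∷ xs) with does (P? (f x))
... | true  = cong (f x ∷_) (filter-map P? f xs)
... | false = filter-map P? f xs

lookup-∷ʳ-inject₁ : ∀ {A : Set} {n} (v : Vec A n) x j → lookup (v ∷ʳ x) (Fin.inject₁ j) ≡ lookup v j
lookup-∷ʳ-inject₁ (y ∷ v) x zero    = refl
lookup-∷ʳ-inject₁ (y ∷ v) x (suc j) = lookup-∷ʳ-inject₁ v x j

lookup-∷ʳ-fromℕ : ∀ {A : Set} {n} (v : Vec A n) x → lookup (v ∷ʳ x) (Fin.fromℕ n) ≡ x
lookup-∷ʳ-fromℕ []      x = refl
lookup-∷ʳ-fromℕ (y ∷ v) x = lookup-∷ʳ-fromℕ v x

pred-inject₁ : ∀ {n} (j : Fin n) → Fin.pred (Fin.inject₁ j) ≡ Fin.inject₁ (Fin.pred j)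
pred-inject₁ zero    = refl
pred-inject₁ (suc j) = refl

-- Membership in `D` depends only on a letter and its predecessor, so an appended letter leaves all
-- earlier positions alone and only the last one remains to be decided.
D-∷ʳ : ∀ {n} (w : Word n) c →
       D (w ∷ʳ c) ≡ map Fin.inject₁ (D w) ++ filter (inD? (w ∷ʳ c)) (Fin.fromℕ n ∷ [])
D-∷ʳ {n} w c = begin
  filter (inD? (w ∷ʳ c)) (allFin (suc n))
    ≡⟨ cong (filter (inD? (w ∷ʳ c))) (allFin-∷ʳ n) ⟩
  filter (inD? (w ∷ʳ c)) (map Fin.inject₁ (allFin n) ++ Fin.fromℕ n ∷ [])
    ≡⟨ Listₚ.filter-++ (inD? (w ∷ʳ c)) (map Fin.inject₁ (allFin n)) _ ⟩
  filter (inD? (w ∷ʳ c)) (map Fin.inject₁ (allFin n)) ++ filter (inD? (w ∷ʳ c)) (Fin.fromℕ n ∷ [])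
    ≡⟨ cong (_++ filter (inD? (w ∷ʳ c)) (Fin.fromℕ n ∷ [])) (trans
         (filter-map (inD? (w ∷ʳ c)) Fin.inject₁ (allFin n))
         (cong (map Fin.inject₁) (Listₚ.filter-≐ (inD? (w ∷ʳ c) ∘ Fin.inject₁) (inD? w)
           ((λ {j} → to j) , (λ {j} → from j)) (allFin n)))) ⟩
  map Fin.inject₁ (D w) ++ filter (inD? (w ∷ʳ c)) (Fin.fromℕ n ∷ []) ∎
  where
  open ≡-Reasoning
  lookup-pred : ∀ j → lookup (w ∷ʳ c) (Fin.pred (Fin.inject₁ j)) ≡ lookup w (Fin.pred j)
  lookup-pred j = trans (cong (lookup (w ∷ʳ c)) (pred-inject₁ j)) (lookup-∷ʳ-inject₁ w c (Fin.pred j))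
  to : ∀ j → InD (w ∷ʳ c) (Fin.inject₁ j) → InD w j
  to j (isL , inj₁ j≡0) =
    trans (sym (lookup-∷ʳ-inject₁ w c j)) isL , inj₁ (trans (sym (Finₚ.toℕ-inject₁ j)) j≡0)
  to j (isL , inj₂ isR) =
    trans (sym (lookup-∷ʳ-inject₁ w c j)) isL , inj₂ (trans (sym (lookup-pred j)) isR)
  from : ∀ j → InD w j → InD (w ∷ʳ c) (Fin.inject₁ j)
  from j (isL , inj₁ j≡0) =
    trans (lookup-∷ʳ-inject₁ w c j) isL , inj₁ (trans (Finₚ.toℕ-inject₁ j) j≡0)
  from j (isL , inj₂ isR) =
    trans (lookup-∷ʳ-inject₁ w c j) isL , inj₂ (trans (lookup-pred j) isR)

weight : ∀ {n} → Word n → Series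
weight w = q^ sum (map toℕ (D w)) t^ length (D w)

weight-∷ʳ-reject : ∀ {n} (w : Word n) c → ¬ InD (w ∷ʳ c) (Fin.fromℕ n) →
                   weight (w ∷ʳ c) ≡ weight w
weight-∷ʳ-reject {n} w c ¬in = cong₂ q^_t^_
  (cong sum (trans (cong (map toℕ) D≡) (trans (sym (Listₚ.map-∘ (D w)))
    (Listₚ.map-cong Finₚ.toℕ-inject₁ (D w)))))
  (trans (cong length D≡) (Listₚ.length-map Fin.inject₁ (D w)))
  where
  D≡ : D (w ∷ʳ c) ≡ map Fin.inject₁ (D w)
  D≡ = trans (D-∷ʳ w c) (trans (cong (map Fin.inject₁ (D w) ++_)
    (Listₚ.filter-reject (inD? (w ∷ʳ c)) ¬in)) (Listₚ.++-identityʳ _))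

q^t^-shift : ∀ s c l → q^ (s ℕ.+ c) t^ (l ℕ.+ 1) ≈ shift c (q^ s t^ l)
q^t^-shift s c l i n = trans
  (cong₂ (λ x y → (q^ x t^ y) i n) (ℕₚ.+-comm s c) (ℕₚ.+-comm l 1)) (go c i n)
  where
  go : ∀ c → q^ (c ℕ.+ s) t^ (suc l) ≈ shift c (q^ s t^ l)
  go zero    i       zero    = cong ℤ.+_ (ℕₚ.*-zeroʳ (𝟙 (s ℕ.≟ i)))
  go zero    i       (suc n) = refl
  go (suc c) zero    zero    = refl
  go (suc c) zero    (suc n) = refl
  go (suc c) (suc i) zero    = go c i zero
  go (suc c) (suc i) (suc n) = go c i (suc n)

-- Positions count from 0, so the appended letter sits at position n and contributes qⁿ t.
weight-∷ʳ-accept : ∀ {n} (w : Word n) c → InD (w ∷ʳ c) (Fin.fromℕ n) →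
                   weight (w ∷ʳ c) ≈ shift n (weight w)
weight-∷ʳ-accept {n} w c in′ i k = trans
  (cong₂ (λ x y → (q^ x t^ y) i k)
    (trans (cong sum positions≡) (trans (sum-++ (map toℕ (D w)) (n ∷ []))
      (cong (sum (map toℕ (D w)) ℕ.+_) (ℕₚ.+-identityʳ n))))
    (trans (cong length D≡) (trans (Listₚ.length-++ (map Fin.inject₁ (D w)))
      (cong (ℕ._+ 1) (Listₚ.length-map Fin.inject₁ (D w))))))
  (q^t^-shift (sum (map toℕ (D w))) n (length (D w)) i k)
  where
  D≡ : D (w ∷ʳ c) ≡ map Fin.inject₁ (D w) ++ Fin.fromℕ n ∷ []
  D≡ = trans (D-∷ʳ w c) (cong (map Fin.inject₁ (D w) ++_)
    (Listₚ.filter-accept (inD? (w ∷ʳ c)) in′))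
  positions≡ : map toℕ (D (w ∷ʳ c)) ≡ map toℕ (D w) ++ n ∷ []
  positions≡ = trans (cong (map toℕ) D≡) (trans
    (Listₚ.map-++ toℕ (map Fin.inject₁ (D w)) (Fin.fromℕ n ∷ []))
    (cong₂ _++_ (trans (sym (Listₚ.map-∘ (D w))) (Listₚ.map-cong Finₚ.toℕ-inject₁ (D w)))
                (cong (_∷ []) (Finₚ.toℕ-fromℕ n))))

lookup-∷ʳ-∷ʳ : ∀ {n} (w : Word n) c d →
               lookup ((w ∷ʳ c) ∷ʳ d) (Fin.pred (Fin.fromℕ (suc n))) ≡ c
lookup-∷ʳ-∷ʳ {n} w c d = trans (lookup-∷ʳ-inject₁ (w ∷ʳ c) d (Fin.fromℕ n)) (lookup-∷ʳ-fromℕ w c)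

weight-R : ∀ {n} (w : Word n) → weight (w ∷ʳ R) ≡ weight w
weight-R w = weight-∷ʳ-reject w R λ (isL , _) →
  contradiction (trans (sym (lookup-∷ʳ-fromℕ w R)) isL) λ ()

weight-LL : ∀ {n} (w : Word n) → weight ((w ∷ʳ L) ∷ʳ L) ≡ weight (w ∷ʳ L)
weight-LL w = weight-∷ʳ-reject (w ∷ʳ L) L λ
  { (_ , inj₁ ())
  ; (_ , inj₂ isR) → contradiction (trans (sym (lookup-∷ʳ-∷ʳ w L L)) isR) λ ()
  }

weight-RL : ∀ {n} (w : Word n) → weight ((w ∷ʳ R) ∷ʳ L) ≈ shift (suc n) (weight w)
weight-RL {n} w i k = trans
  (weight-∷ʳ-accept (w ∷ʳ R) L
    (lookup-∷ʳ-fromℕ (w ∷ʳ R) L , inj₂ (lookup-∷ʳ-∷ʳ w R L)) i k)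
  (cong (λ F → shift (suc n) F i k) (weight-R w))

-- Generating functions of words by end point

letters : List Letter
letters = L ∷ R ∷ []

-- Read backwards, `w` is a walk that starts in (a , b), where L increases a and R increases b;
-- words whose walk leaves the region a ≤ b count as zero.
wordTerm : ∀ {n} → ℕ → ℕ → Word n → Series
wordTerm a b w i k = when (bal? a b (backwards w)) (weight w i k)

-- The first argument is the rank plus one, so that index 0 stands for the empty ideal.
V : ℕ → ℕ → ℕ → Series
V zero    a b = 𝟏
V (suc n) a b = ∑ (tuples letters n) (wordTerm a b)

wordTerm-∷ʳ : ∀ {n} a b (w : Word n) c i k → wordTerm a b (w ∷ʳ c) i k ≡
              when (bal? a b (c ∷ backwards w)) (weight (w ∷ʳ c) i k)
wordTerm-∷ʳ a b w c i k = cong (λ v → when (bal? a b v) (weight (w ∷ʳ c) i k)) (backwards-∷ʳ w c)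

bal⇒≤ : ∀ a b v → Bal a b v → a ℕ.≤ b
bal⇒≤ a b []      p       = p
bal⇒≤ a b (L ∷ v) (p , _) = p
bal⇒≤ a b (R ∷ v) (p , _) = p

wordTerm-R : ∀ {n} a b (w : Word n) → a ℕ.≤ b → wordTerm a b (w ∷ʳ R) ≈ wordTerm a (suc b) w
wordTerm-R a b w a≤b i k = trans (wordTerm-∷ʳ a b w R i k)
  (when-cong (bal? a b (R ∷ backwards w)) (bal? a (suc b) (backwards w)) proj₂ (a≤b ,_) (cong (λ F → F i k) (weight-R w)))

wordTerm-L : ∀ {n} a b (w : Word n) → a ℕ.≤ b → ∀ i k →
             wordTerm a b (w ∷ʳ L) i k ≡ when (bal? (suc a) b (backwards w)) (weight (w ∷ʳ L) i k)
wordTerm-L a b w a≤b i k = trans (wordTerm-∷ʳ a b w L i k)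
  (when-cong (bal? a b (L ∷ backwards w)) (bal? (suc a) b (backwards w)) proj₂ (a≤b ,_) refl)

-- Read backwards, a final L would lead from (a , a) to (a + 1 , a), outside the region.
wordTerm-L-diagonal : ∀ {n} a (w : Word n) i k → wordTerm a a (w ∷ʳ L) i k ≡ 0ℤ
wordTerm-L-diagonal a w i k = trans (wordTerm-∷ʳ a a w L i k)
  (when-no (bal? a a (L ∷ backwards w)) λ (_ , p) → ℕₚ.<-irrefl refl (bal⇒≤ (suc a) a (backwards w) p))

wordTerm-LL : ∀ {n} a b (w : Word n) → a ℕ.≤ b →
              wordTerm a b ((w ∷ʳ L) ∷ʳ L) ≈ wordTerm (suc a) b (w ∷ʳ L)
wordTerm-LL a b w a≤b i k = trans (wordTerm-L a b (w ∷ʳ L) a≤b i k)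
  (cong (λ F → when (bal? (suc a) b (backwards (w ∷ʳ L))) (F i k)) (weight-LL w))

-- Deleting the final RL moves the end to (a + 1 , b + 1) through (a + 1 , b), which is admissible
-- because a < b. The L follows an R, so its position n + 1 lies in `D`.
wordTerm-RL : ∀ {n} a b (w : Word n) → a ℕ.< b →
              wordTerm a b ((w ∷ʳ R) ∷ʳ L) ≈ shift (suc n) (wordTerm (suc a) (suc b) w)
wordTerm-RL {n} a b w a<b i k = begin
  wordTerm a b ((w ∷ʳ R) ∷ʳ L) i k
    ≡⟨ wordTerm-L a b (w ∷ʳ R) (ℕₚ.<⇒≤ a<b) i k ⟩
  when (bal? (suc a) b (backwards (w ∷ʳ R))) (weight ((w ∷ʳ R) ∷ʳ L) i k)
    ≡⟨ cong₂ (λ v z → when (bal? (suc a) b v) z) (backwards-∷ʳ w R) (weight-RL w i k) ⟩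
  when (bal? (suc a) b (R ∷ backwards w)) (shift (suc n) (weight w) i k)
    ≡⟨ when-cong (bal? (suc a) b (R ∷ backwards w)) (bal? (suc a) (suc b) (backwards w)) proj₂ (a<b ,_) refl ⟩
  when (bal? (suc a) (suc b) (backwards w)) (shift (suc n) (weight w) i k)
    ≡⟨ shift-when (suc n) (bal? (suc a) (suc b) (backwards w)) (weight w) i k ⟨
  shift (suc n) (wordTerm (suc a) (suc b) w) i k ∎
  where open ≡-Reasoning

-- Words that end on the diagonal end in R, and a final R carries no weight.
V-diagonal : ∀ n a → V (suc (suc n)) a a ≈ V (suc n) a (suc a)
V-diagonal n a i k = trans (total-tuples-∷ʳ letters n (λ w → wordTerm a a w i k))
  (total-cong (tuples letters n) λ w → begin
    wordTerm a a (w ∷ʳ L) i k ℤ.+ (wordTerm a a (w ∷ʳ R) i k ℤ.+ 0ℤ)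
      ≡⟨ cong₂ (λ x y → x ℤ.+ (y ℤ.+ 0ℤ)) (wordTerm-L-diagonal a w i k) (wordTerm-R a a w ℕₚ.≤-refl i k) ⟩
    0ℤ ℤ.+ (wordTerm a (suc a) w i k ℤ.+ 0ℤ)
      ≡⟨ l (wordTerm a (suc a) w i k) ⟩
    wordTerm a (suc a) w i k ∎)
  where
  open ≡-Reasoning
  l : ∀ x → 0ℤ ℤ.+ (x ℤ.+ 0ℤ) ≡ x
  l = solve-∀

V-minimal : ∀ a b → a ℕ.≤ b → V 1 a b ≈ 𝟏
V-minimal a b a≤b i k = trans (ℤₚ.+-identityʳ _) (when-yes (a ℕ.≤? b) a≤b)

-- Words ending in R give V (n + 1) a (b + 1). Deleting a final L gives V (n + 1) (a + 1) b, with
-- the correct weight if another L precedes it. After an R the deleted letter, at position n,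
-- contributed qⁿ t, so V n (a + 1) (b + 1) has to be replaced by its shift; subtracting `Δ n` of it
-- does this.
V-step : ∀ n a b → a ℕ.< b →
         V (suc (suc n)) a b ≈ V (suc n) (suc a) b ⊖ (Δ n (V n (suc a) (suc b)) ⊖ V (suc n) a (suc b))
-- The one-letter word L has weight t as the first letter, without an R before it. The value 𝟏 of
-- `V zero` makes the general formula cover this case.
V-step zero    a b a<b i k = begin
  V 2 a b i k
    ≡⟨ cong₂ (λ x y → x ℤ.+ (y ℤ.+ 0ℤ)) {y = (q^ 0 t^ 1) i k} {v = 𝟏 i k}
         (when-yes (bal? a b (L ∷ [])) (ℕₚ.<⇒≤ a<b , a<b))
         (when-yes (bal? a b (R ∷ [])) (ℕₚ.<⇒≤ a<b , ℕₚ.m≤n⇒m≤1+n (ℕₚ.<⇒≤ a<b))) ⟩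
  (q^ 0 t^ 1) i k ℤ.+ (𝟏 i k ℤ.+ 0ℤ)
    ≡⟨ cong (ℤ._+ (𝟏 i k ℤ.+ 0ℤ)) (q^t^-shift 0 0 0 i k) ⟩
  shift 0 𝟏 i k ℤ.+ (𝟏 i k ℤ.+ 0ℤ)
    ≡⟨ l (shift 0 𝟏 i k) (𝟏 i k) ⟩
  𝟏 i k ℤ.- ((𝟏 i k ℤ.- shift 0 𝟏 i k) ℤ.- 𝟏 i k)
    ≡⟨ cong₂ (λ x y → x ℤ.- ((𝟏 i k ℤ.- shift 0 𝟏 i k) ℤ.- y))
         (V-minimal (suc a) b a<b i k) (V-minimal a (suc b) (ℕₚ.m≤n⇒m≤1+n (ℕₚ.<⇒≤ a<b)) i k) ⟨
  (V 1 (suc a) b ⊖ (Δ 0 𝟏 ⊖ V 1 a (suc b))) i k ∎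
  where
  open ≡-Reasoning
  l : ∀ x y → x ℤ.+ (y ℤ.+ 0ℤ) ≡ y ℤ.- ((y ℤ.- x) ℤ.- y)
  l = solve-∀
V-step (suc n) a b a<b i k = begin
  V (3 ℕ.+ n) a b i k
    ≡⟨ trans (total-tuples-∷ʳ letters (suc n) _) (total-tuples-∷ʳ letters n _) ⟩
  total ws (λ w → total letters λ c → total letters λ d → wordTerm a b ((w ∷ʳ c) ∷ʳ d) i k)
    ≡⟨ total-cong ws term ⟩
  total ws (λ w → g w ℤ.- ((h w ℤ.- h′ w) ℤ.- k′ w))
    ≡⟨ trans (total-- ws g _) (cong (ℤ._-_ (total ws g)) (trans (total-- ws _ k′)
         (cong (ℤ._- total ws k′) (total-- ws h h′)))) ⟩
  total ws g ℤ.- ((total ws h ℤ.- total ws h′) ℤ.- total ws k′)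
    ≡⟨ cong₂ ℤ._-_ (total-tuples-∷ʳ letters n (λ w → wordTerm (suc a) b w i k))
         (cong₂ ℤ._-_ (cong (ℤ._-_ (total ws h)) (shift-∑ (suc n) ws (wordTerm (suc a) (suc b)) i k))
                      (total-tuples-∷ʳ letters n (λ w → wordTerm a (suc b) w i k))) ⟨
  (V (2 ℕ.+ n) (suc a) b ⊖ (Δ (suc n) (V (suc n) (suc a) (suc b)) ⊖ V (2 ℕ.+ n) a (suc b))) i k ∎
  where
  open ≡-Reasoning
  ws = tuples letters n
  g h h′ k′ : Word n → ℤ
  g w  = total letters λ c → wordTerm (suc a) b (w ∷ʳ c) i k
  h w  = wordTerm (suc a) (suc b) w i k
  h′ w = shift (suc n) (wordTerm (suc a) (suc b) w) i k
  k′ w = total letters λ c → wordTerm a (suc b) (w ∷ʳ c) i k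
  a≤b = ℕₚ.<⇒≤ a<b
  l : ∀ gL h h′ kL kR → (gL ℤ.+ (kL ℤ.+ 0ℤ)) ℤ.+ ((h′ ℤ.+ (kR ℤ.+ 0ℤ)) ℤ.+ 0ℤ) ≡
      (gL ℤ.+ (h ℤ.+ 0ℤ)) ℤ.- ((h ℤ.- h′) ℤ.- (kL ℤ.+ (kR ℤ.+ 0ℤ)))
  l = solve-∀
  term : ∀ w → total letters (λ c → total letters λ d → wordTerm a b ((w ∷ʳ c) ∷ʳ d) i k) ≡
               g w ℤ.- ((h w ℤ.- h′ w) ℤ.- k′ w)
  term w = begin
    (f L L ℤ.+ (f L R ℤ.+ 0ℤ)) ℤ.+ ((f R L ℤ.+ (f R R ℤ.+ 0ℤ)) ℤ.+ 0ℤ)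
      ≡⟨ cong₂ (λ x y → x ℤ.+ (y ℤ.+ 0ℤ))
           (cong₂ (λ x y → x ℤ.+ (y ℤ.+ 0ℤ)) (wordTerm-LL a b w a≤b i k) (wordTerm-R a b (w ∷ʳ L) a≤b i k))
           (cong₂ (λ x y → x ℤ.+ (y ℤ.+ 0ℤ)) (wordTerm-RL a b w a<b i k) (wordTerm-R a b (w ∷ʳ R) a≤b i k)) ⟩
    (gL ℤ.+ (kL ℤ.+ 0ℤ)) ℤ.+ ((h′ w ℤ.+ (kR ℤ.+ 0ℤ)) ℤ.+ 0ℤ)
      ≡⟨ l gL (h w) (h′ w) kL kR ⟩
    (gL ℤ.+ (h w ℤ.+ 0ℤ)) ℤ.- ((h w ℤ.- h′ w) ℤ.- k′ w)
      -- `h w` is also the contribution of the letter R to `g w`; the subtracted difference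
      -- exchanges it for the shifted `h′ w`.
      ≡⟨ cong (λ x → (gL ℤ.+ (x ℤ.+ 0ℤ)) ℤ.- ((h w ℤ.- h′ w) ℤ.- k′ w)) (wordTerm-R (suc a) b w a<b i k) ⟨
    g w ℤ.- ((h w ℤ.- h′ w) ℤ.- k′ w) ∎
    where
    f : Letter → Letter → ℤ
    f c d = wordTerm a b ((w ∷ʳ c) ∷ʳ d) i k
    gL = wordTerm (suc a) b (w ∷ʳ L) i k
    kL = wordTerm a (suc b) (w ∷ʳ L) i k
    kR = wordTerm a (suc b) (w ∷ʳ R) i k

wordPolynomial-V : ∀ r → wordPolynomial r ≈ V (suc (2 ℕ.* r ℕ.∸ 2)) 0 0
wordPolynomial-V r i k = trans (total-filter (λ w → ballot? (backwards w)) ws _)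
  (total-cong ws λ w → when-cong (ballot? (backwards w)) (bal? 0 0 (backwards w))
    (ballotFrom⇒bal 0 0 _) (bal⇒ballotFrom 0 0 _) refl)
  where
  ws = tuples letters (2 ℕ.* r ℕ.∸ 2)

-- Weak chains

-- Shifts in q never touch the t-index. This permits comparing a weight sum placed in t-degree 0
-- with the coefficient of tᵐ in `chainsBelow`.
shiftq-column : ∀ c {F G m n} → (∀ i → F i m ≡ G i n) → ∀ i → shiftq c F i m ≡ shiftq c G i n
shiftq-column zero    p i       = p i
shiftq-column (suc c) p zero    = refl
shiftq-column (suc c) p (suc i) = shiftq-column c p i

q^-shiftq : ∀ s c → q^ (s ℕ.+ c) t^ 0 ≈ shiftq c (q^ s t^ 0)
q^-shiftq s c i n = trans (cong (λ x → (q^ x t^ 0) i n) (ℕₚ.+-comm s c)) (go c i n)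
  where
  go : ∀ c → q^ (c ℕ.+ s) t^ 0 ≈ shiftq c (q^ s t^ 0)
  go zero    i       n = refl
  go (suc c) zero    n = refl
  go (suc c) (suc i) n = go c i n

sum-map-∷ʳ : ∀ {A : Set} {n} (f : A → ℕ) (v : Vec A n) x →
             Vec.sum (Vec.map f (v ∷ʳ x)) ≡ Vec.sum (Vec.map f v) ℕ.+ f x
sum-map-∷ʳ f []      x = ℕₚ.+-identityʳ (f x)
sum-map-∷ʳ f (y ∷ v) x = trans (cong (f y ℕ.+_) (sum-map-∷ʳ f v x)) (sym (ℕₚ.+-assoc (f y) _ _))

module _ {A : Set} {_∼_ : A → A → Set} where

  linked-∷ʳ⁻ : ∀ {n} (v : Vec A n) x y → Linked _∼_ ((v ∷ʳ x) ∷ʳ y) → x ∼ y × Linked _∼_ (v ∷ʳ x)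
  linked-∷ʳ⁻ []          x y (p ∷ [-]) = p , [-]
  linked-∷ʳ⁻ (a ∷ [])    x y (p ∷ ps) with q , qs ← linked-∷ʳ⁻ [] x y ps = q , p ∷ qs
  linked-∷ʳ⁻ (a ∷ b ∷ v) x y (p ∷ ps) with q , qs ← linked-∷ʳ⁻ (b ∷ v) x y ps = q , p ∷ qs

  linked-∷ʳ⁺ : ∀ {n} (v : Vec A n) x y → x ∼ y → Linked _∼_ (v ∷ʳ x) → Linked _∼_ ((v ∷ʳ x) ∷ʳ y)
  linked-∷ʳ⁺ []          x y q [-]      = q ∷ [-]
  linked-∷ʳ⁺ (a ∷ [])    x y q (p ∷ ps) = p ∷ linked-∷ʳ⁺ [] x y q ps
  linked-∷ʳ⁺ (a ∷ b ∷ v) x y q (p ∷ ps) = p ∷ linked-∷ʳ⁺ (b ∷ v) x y q ps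

module _ (P : FiniteGradedPoset) where
  open FiniteGradedPoset P renaming (_≤_ to _≤ᴾ_)

  chainWeight : ∀ {m} → Vec Carrier m → Series
  chainWeight v = q^ Vec.sum (Vec.map ρ v) t^ 0

  -- The bound y is encoded as one more last element of the chain, which by transitivity bounds all
  -- others; it is left out of the weight.
  chainsBelow : Carrier → Series
  chainsBelow y i m = total (tuples elements m) λ v →
    when (linked? _≤?_ (v ∷ʳ y)) (chainWeight v i 0)

  chains-∷ʳ : ∀ z i m →
    total (tuples elements m) (λ v → when (linked? _≤?_ (v ∷ʳ z)) (chainWeight (v ∷ʳ z) i 0)) ≡
    shiftq (ρ z) (chainsBelow z) i m
  chains-∷ʳ z i m = begin
    total vs (λ v → when (linked? _≤?_ (v ∷ʳ z)) (chainWeight (v ∷ʳ z) i 0))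
      ≡⟨ total-cong vs (λ v → trans
           (cong (when (linked? _≤?_ (v ∷ʳ z)))
             (trans (cong (λ s → (q^ s t^ 0) i 0) (sum-map-∷ʳ ρ v z)) (q^-shiftq (Vec.sum (Vec.map ρ v)) (ρ z) i 0)))
           (sym (shiftq-when (ρ z) (linked? _≤?_ (v ∷ʳ z)) (chainWeight v) i 0))) ⟩
    total vs (λ v → shiftq (ρ z) (λ j n → when (linked? _≤?_ (v ∷ʳ z)) (chainWeight v j n)) i 0)
      ≡⟨ shiftq-∑ (ρ z) vs (λ v j n → when (linked? _≤?_ (v ∷ʳ z)) (chainWeight v j n)) i 0 ⟨
    shiftq (ρ z) (∑ vs (λ v j n → when (linked? _≤?_ (v ∷ʳ z)) (chainWeight v j n))) i 0
      ≡⟨ shiftq-column (ρ z) (λ j → refl) i ⟩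
    shiftq (ρ z) (chainsBelow z) i m ∎
    where
    open ≡-Reasoning
    vs = tuples elements m

  -- The top z of a nonempty chain must satisfy z ≤ y. It contributes q to the power `ρ z` and
  -- leaves a chain below z.
  chainsBelow-suc : ∀ y i m → chainsBelow y i (suc m) ≡
    total elements (λ z → when (z ≤? y) (shiftq (ρ z) (chainsBelow z) i m))
  chainsBelow-suc y i m = begin
    chainsBelow y i (suc m)
      ≡⟨ total-tuples-∷ʳ elements m _ ⟩
    total vs (λ v → total elements λ z → when (linked? _≤?_ ((v ∷ʳ z) ∷ʳ y)) (chainWeight (v ∷ʳ z) i 0))
      ≡⟨ total-swap vs elements _ ⟩
    total elements (λ z → total vs λ v → when (linked? _≤?_ ((v ∷ʳ z) ∷ʳ y)) (chainWeight (v ∷ʳ z) i 0))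
      ≡⟨ total-cong elements (λ z → trans
           (total-cong vs λ v → when-× (z ≤? y) (linked? _≤?_ (v ∷ʳ z)) (linked? _≤?_ ((v ∷ʳ z) ∷ʳ y))
             (linked-∷ʳ⁻ v z y) (linked-∷ʳ⁺ v z y))
           (trans (sym (total-when (z ≤? y) vs _)) (cong (when (z ≤? y)) (chains-∷ʳ z i m)))) ⟩
    total elements (λ z → when (z ≤? y) (shiftq (ρ z) (chainsBelow z) i m)) ∎
    where
    open ≡-Reasoning
    vs = tuples elements m

  zeta-suc : ∀ i m → zeta P i (suc m) ≡ total elements (λ z → shiftq (ρ z) (chainsBelow z) i m)
  zeta-suc i m = begin
    zeta P i (suc m)
      ≡⟨ total-filter (linked? _≤?_) (tuples elements (suc m)) _ ⟩
    total (tuples elements (suc m)) (λ v → when (linked? _≤?_ v) (chainWeight v i 0))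
      ≡⟨ total-tuples-∷ʳ elements m _ ⟩
    total vs (λ v → total elements λ z → when (linked? _≤?_ (v ∷ʳ z)) (chainWeight (v ∷ʳ z) i 0))
      ≡⟨ total-swap vs elements _ ⟩
    total elements (λ z → total vs λ v → when (linked? _≤?_ (v ∷ʳ z)) (chainWeight (v ∷ʳ z) i 0))
      ≡⟨ total-cong elements (λ z → chains-∷ʳ z i m) ⟩
    total elements (λ z → shiftq (ρ z) (chainsBelow z) i m) ∎
    where
    open ≡-Reasoning
    vs = tuples elements m

-- Posets of lattice points in a triangle

when-≤-split : ∀ a p x → when (a ℕ.≤? p) x ≡ when (a ℕ.≟ p) x ℤ.+ when (suc a ℕ.≤? p) x
when-≤-split a p x with ℕₚ.<-cmp a p
... | tri< a<p a≢p _ = trans (when-yes (a ℕ.≤? p) (ℕₚ.<⇒≤ a<p))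
  (sym (trans (cong₂ ℤ._+_ (when-no (a ℕ.≟ p) a≢p) (when-yes (suc a ℕ.≤? p) a<p)) (ℤₚ.+-identityˡ x)))
... | tri≈ a≮p a≡p _ = trans (when-yes (a ℕ.≤? p) (ℕₚ.≤-reflexive a≡p))
  (sym (trans (cong₂ ℤ._+_ (when-yes (a ℕ.≟ p) a≡p) (when-no (suc a ℕ.≤? p) a≮p)) (ℤₚ.+-identityʳ x)))
... | tri> a≮p a≢p p<a = trans (when-no (a ℕ.≤? p) (ℕₚ.<⇒≱ p<a))
  (sym (cong₂ ℤ._+_ (when-no (a ℕ.≟ p) a≢p) (when-no (suc a ℕ.≤? p) a≮p)))

when-+ : ∀ {P : Set} (p : Dec P) x y → when p (x ℤ.+ y) ≡ when p x ℤ.+ when p y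
when-+ (yes _) x y = refl
when-+ (no  _) x y = refl

-- Inclusion–exclusion: a quadrant with its corner removed is the union of two quadrants.
when-quadrant : ∀ a b p q x →
  when (a ℕ.≤? p) (when (b ℕ.≤? q) x) ≡
  (when (suc a ℕ.≤? p) (when (b ℕ.≤? q) x) ℤ.-
    (when (suc a ℕ.≤? p) (when (suc b ℕ.≤? q) x) ℤ.- when (a ℕ.≤? p) (when (suc b ℕ.≤? q) x)))
  ℤ.+ when (a ℕ.≟ p) (when (b ℕ.≟ q) x)
when-quadrant a b p q x = begin
  when (a ℕ.≤? p) Y
    ≡⟨ when-≤-split a p Y ⟩
  when (a ℕ.≟ p) Y ℤ.+ when (suc a ℕ.≤? p) Y
    ≡⟨ cong (ℤ._+ when (suc a ℕ.≤? p) Y)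
         (trans (cong (when (a ℕ.≟ p)) (when-≤-split b q x)) (when-+ (a ℕ.≟ p) (when (b ℕ.≟ q) x) Y′)) ⟩
  when (a ℕ.≟ p) (when (b ℕ.≟ q) x) ℤ.+ when (a ℕ.≟ p) Y′ ℤ.+ when (suc a ℕ.≤? p) Y
    ≡⟨ l (when (a ℕ.≟ p) (when (b ℕ.≟ q) x)) (when (a ℕ.≟ p) Y′)
         (when (suc a ℕ.≤? p) Y) (when (suc a ℕ.≤? p) Y′) ⟩
  (when (suc a ℕ.≤? p) Y ℤ.- (when (suc a ℕ.≤? p) Y′ ℤ.-
    (when (a ℕ.≟ p) Y′ ℤ.+ when (suc a ℕ.≤? p) Y′))) ℤ.+ when (a ℕ.≟ p) (when (b ℕ.≟ q) x)
    ≡⟨ cong (λ y → (when (suc a ℕ.≤? p) Y ℤ.- (when (suc a ℕ.≤? p) Y′ ℤ.- y))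
                   ℤ.+ when (a ℕ.≟ p) (when (b ℕ.≟ q) x)) (when-≤-split a p Y′) ⟨
  (when (suc a ℕ.≤? p) Y ℤ.- (when (suc a ℕ.≤? p) Y′ ℤ.- when (a ℕ.≤? p) Y′))
    ℤ.+ when (a ℕ.≟ p) (when (b ℕ.≟ q) x) ∎
  where
  open ≡-Reasoning
  Y Y′ : ℤ
  Y  = when (b ℕ.≤? q) x
  Y′ = when (suc b ℕ.≤? q) x
  l : ∀ d e y y′ → d ℤ.+ e ℤ.+ y ≡ (y ℤ.- (y′ ℤ.- (e ℤ.+ y′))) ℤ.+ d
  l = solve-∀

foldr-⊔ : ∀ {A : Set} (f : A → ℕ) {N} (xs : List A) {x} →
          (∀ y → f y ℕ.≤ N) → x ∈ xs → f x ≡ N → foldr ℕ._⊔_ 0 (map f xs) ≡ N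
foldr-⊔ f {N} xs f≤N x∈ fx≡N = ℕₚ.≤-antisym (upper xs) (subst (ℕ._≤ _) fx≡N (lower x∈))
  where
  upper : ∀ xs → foldr ℕ._⊔_ 0 (map f xs) ℕ.≤ N
  upper []       = z≤n
  upper (y ∷ ys) = ℕₚ.⊔-lub (f≤N y) (upper ys)
  lower : ∀ {x xs} → x ∈ xs → f x ℕ.≤ foldr ℕ._⊔_ 0 (map f xs)
  lower {xs = y ∷ ys} (here refl) = ℕₚ.m≤m⊔n (f y) _
  lower {xs = y ∷ ys} (there x∈)  = ℕₚ.≤-trans (lower x∈) (ℕₚ.m≤n⊔m (f y) _)

-- P is the set of lattice points 0 ≤ a ≤ b with a + b ≤ N, where (0 , 0) is the
-- maximum and the rank is N - a - b.
record Triangle (P : FiniteGradedPoset) (N : ℕ) : Set where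
  open FiniteGradedPoset P renaming (_≤_ to _≤ᴾ_)
  field
    α β     : Carrier → ℕ
    ≤⇒      : ∀ {x y} → x ≤ᴾ y → α y ℕ.≤ α x × β y ℕ.≤ β x
    ⇒≤      : ∀ {x y} → α y ℕ.≤ α x × β y ℕ.≤ β x → x ≤ᴾ y
    α≤β     : ∀ x → α x ℕ.≤ β x
    rank    : ∀ x → α x ℕ.+ β x ℕ.+ ρ x ≡ N
    point   : ∀ a b → a ℕ.≤ b → a ℕ.+ b ℕ.≤ N → ∃ λ x → α x ≡ a × β x ≡ b

module _ {P : FiniteGradedPoset} {N : ℕ} (T : Triangle P N) where
  open FiniteGradedPoset P renaming (_≤_ to _≤ᴾ_)
  open Triangle T

  -- Weak chains in the ideal of the points (p , q) with a ≤ p and b ≤ q, split by their top z.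
  Z : ℕ → ℕ → Series
  Z a b i zero    = 𝟏 i 0
  Z a b i (suc m) = total elements λ z →
    when (a ℕ.≤? α z) (when (b ℕ.≤? β z) (shiftq (ρ z) (chainsBelow P z) i m))

  chainsBelow-Z : ∀ y → chainsBelow P y ≈ Z (α y) (β y)
  chainsBelow-Z y i zero    = ℤₚ.+-identityʳ _
  chainsBelow-Z y i (suc m) = trans (chainsBelow-suc P y i m)
    (total-cong elements λ z → when-× (α y ℕ.≤? α z) (β y ℕ.≤? β z) (z ≤? y) ≤⇒ λ p q → ⇒≤ (p , q))

  zeta-Z : zeta P ≈ Z 0 0
  zeta-Z i zero    = ℤₚ.+-identityʳ _
  -- The bounds 0 ≤ α z and 0 ≤ β z are decided by computation, so both conditions disappear.
  zeta-Z i (suc m) = zeta-suc P i m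

  -- All points satisfy α ≤ β, so α ≥ a + 1 already forces β ≥ a + 1.
  Z-diagonal : ∀ a → Z (suc a) a ≈ Z (suc a) (suc a)
  Z-diagonal a i zero    = refl
  Z-diagonal a i (suc m) = total-cong elements λ z → trans
    (sym (when-× (suc a ℕ.≤? α z) (a ℕ.≤? β z) (suc a ℕ.≤? α z)
      (λ p → p , ℕₚ.<⇒≤ (ℕₚ.≤-trans p (α≤β z))) λ p _ → p))
    (when-× (suc a ℕ.≤? α z) (suc a ℕ.≤? β z) (suc a ℕ.≤? α z)
      (λ p → p , ℕₚ.≤-trans p (α≤β z)) λ p _ → p)

  -- Coordinates of a point sum to at most N, so the quadrant contains no point and only the empty
  -- chain remains.
  Z-empty : ∀ a b → N ℕ.< a ℕ.+ b → Z a b ≈ 𝟏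
  Z-empty a b N<a+b i zero    = refl
  Z-empty a b N<a+b i (suc m) = trans
    (total-zero (All.universal (λ z → outside z (a ℕ.≤? α z) (b ℕ.≤? β z)) elements))
    (sym (cong ℤ.+_ (ℕₚ.*-zeroʳ (𝟙 (0 ℕ.≟ i)))))
    where
    outside : ∀ z (p : Dec (a ℕ.≤ α z)) (q : Dec (b ℕ.≤ β z)) {x} → when p (when q x) ≡ 0ℤ
    outside z (no _)  _       = refl
    outside z (yes _) (no _)  = refl
    outside z (yes p) (yes q) = contradiction
      (ℕₚ.≤-trans (ℕₚ.+-mono-≤ p q) (ℕₚ.≤-trans (ℕₚ.m≤m+n _ (ρ z)) (ℕₚ.≤-reflexive (rank z))))
      (ℕₚ.<⇒≱ N<a+b)

  Z-step : ∀ a b n → a ℕ.≤ b → a ℕ.+ b ℕ.+ n ≡ N →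
           Δ n (Z a b) ≈ Z (suc a) b ⊖ (Z (suc a) (suc b) ⊖ Z a (suc b))
  -- In t-degree 0 every `Z` counts just the empty chain.
  Z-step a b n a≤b eq i zero    = l (𝟏 i 0)
    where
    l : ∀ x → x ℤ.- 0ℤ ≡ x ℤ.- (x ℤ.- x)
    l = solve-∀
  Z-step a b n a≤b eq i (suc m) with x , refl , refl ← point a b a≤b (ℕₚ.m+n≤o⇒m≤o _ (ℕₚ.≤-reflexive eq))
    = begin
    Z a b i (suc m) ℤ.- shiftq n (Z a b) i m
      ≡⟨ cong₂ ℤ._-_ Z-split corner ⟩
    (rest ℤ.+ g x) ℤ.- g x
      ≡⟨ l rest (g x) ⟩
    rest ∎
    where
    open ≡-Reasoning
    l : ∀ x y → (x ℤ.+ y) ℤ.- y ≡ x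
    l = solve-∀
    g : Carrier → ℤ
    g z = shiftq (ρ z) (chainsBelow P z) i m
    rest : ℤ
    rest = (Z (suc a) b ⊖ (Z (suc a) (suc b) ⊖ Z a (suc b))) i (suc m)
    quadrant : ℕ → ℕ → Carrier → ℤ
    quadrant a b z = when (a ℕ.≤? α z) (when (b ℕ.≤? β z) (g z))
    at : Carrier → ℤ
    at z = when (a ℕ.≟ α z) (when (b ℕ.≟ β z) (g z))
    -- By antisymmetry the two coordinates determine a point, so x is the only point at the corner.
    at-off : ∀ z → z ≢ x → at z ≡ 0ℤ
    at-off z z≢x = off (a ℕ.≟ α z) (b ℕ.≟ β z)
      where
      off : (p : Dec (a ≡ α z)) (q : Dec (b ≡ β z)) → when p (when q (g z)) ≡ 0ℤ
      off (no _)  _       = refl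
      off (yes _) (no _)  = refl
      off (yes p) (yes q) = contradiction (antisym
        (⇒≤ (ℕₚ.≤-reflexive p , ℕₚ.≤-reflexive q))
        (⇒≤ (ℕₚ.≤-reflexive (sym p) , ℕₚ.≤-reflexive (sym q)))) z≢x
        where open IsDecPartialOrder isDecPartialOrder using (antisym)
    -- The ideal of the corner x is the whole quadrant and its rank is n, so the chains with top x
    -- give exactly the term that `Δ n` subtracts.
    corner : shiftq n (Z a b) i m ≡ g x
    corner = trans (cong (λ c → shiftq c (Z a b) i m)
                     (ℕₚ.+-cancelˡ-≡ (a ℕ.+ b) n (ρ x) (trans eq (sym (rank x)))))
                   (sym (shiftq-cong (ρ x) (chainsBelow-Z x) i m))
    Z-split : Z a b i (suc m) ≡ rest ℤ.+ g x
    Z-split = begin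
      total elements (quadrant a b)
        ≡⟨ total-cong elements (λ z → when-quadrant a b (α z) (β z) (g z)) ⟩
      total elements (λ z → (quadrant (suc a) b z ℤ.- (quadrant (suc a) (suc b) z ℤ.- quadrant a (suc b) z)) ℤ.+ at z)
        ≡⟨ total-+ elements _ at ⟩
      total elements (λ z → quadrant (suc a) b z ℤ.- (quadrant (suc a) (suc b) z ℤ.- quadrant a (suc b) z))
        ℤ.+ total elements at
        ≡⟨ cong₂ ℤ._+_
             (trans (total-- elements (quadrant (suc a) b) _)
               (cong (ℤ._-_ (total elements (quadrant (suc a) b)))
                 (total-- elements (quadrant (suc a) (suc b)) (quadrant a (suc b)))))
             (trans (total-point at unique (complete x) at-off)
               (trans (when-yes (a ℕ.≟ α x) refl) (when-yes (b ℕ.≟ β x) refl))) ⟩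
      rest ℤ.+ g x ∎

  -- Induction on ℓ, the rank of (a , b) plus one. After `Z-step` has used the largest factor, those
  -- left are exactly the ones for (a + 1 , b) and (a , b + 1), and one too many for (a + 1 , b +
  -- 1); the surplus factor is the `Δ` in `V-step`.
  Δs-Z : ∀ ℓ a b → a ℕ.≤ b → a ℕ.+ b ℕ.+ ℓ ≡ suc N → Δs (upTo ℓ) (Z a b) ≈ V ℓ a b
  -- Here a + b = N + 1, just outside the triangle.
  Δs-Z zero a b a≤b eq = Z-empty a b (ℕₚ.≤-reflexive (trans (sym eq) (ℕₚ.+-identityʳ (a ℕ.+ b))))
  Δs-Z (suc zero) a b a≤b eq i k = begin
    Δ 0 (Z a b) i k
      ≡⟨ Z-step a b 0 a≤b (trans (ℕₚ.+-identityʳ (a ℕ.+ b)) a+b≡N) i k ⟩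
    (Z (suc a) b ⊖ (Z (suc a) (suc b) ⊖ Z a (suc b))) i k
      ≡⟨ cong₂ ℤ._-_ (Z-empty (suc a) b (s≤s N≤a+b) i k) (cong₂ ℤ._-_
           (Z-empty (suc a) (suc b) (s≤s (ℕₚ.≤-trans N≤a+b (ℕₚ.+-monoʳ-≤ a (ℕₚ.n≤1+n b)))) i k)
           (Z-empty a (suc b) (ℕₚ.≤-trans (s≤s N≤a+b) (ℕₚ.≤-reflexive (sym (ℕₚ.+-suc a b)))) i k)) ⟩
    𝟏 i k ℤ.- (𝟏 i k ℤ.- 𝟏 i k)
      ≡⟨ l (𝟏 i k) (𝟏 i k) ⟩
    𝟏 i k
      ≡⟨ V-minimal a b a≤b i k ⟨
    V 1 a b i k ∎
    where
    open ≡-Reasoning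
    l : ∀ x y → x ℤ.- (x ℤ.- y) ≡ y
    l = solve-∀
    a+b≡N : a ℕ.+ b ≡ N
    a+b≡N = ℕₚ.suc-injective (trans (ℕₚ.+-comm 1 (a ℕ.+ b)) eq)
    N≤a+b = ℕₚ.≤-reflexive (sym a+b≡N)
  Δs-Z (suc (suc n)) a b a≤b eq i k = begin
    Δs (upTo (2 ℕ.+ n)) (Z a b) i k
      ≡⟨ cong (λ F → F i k) (Δs-upTo-suc (suc n) (Z a b)) ⟩
    Δs cs (Δ (suc n) (Z a b)) i k
      ≡⟨ Δs-cong cs (Z-step a b (suc n) a≤b (ℕₚ.suc-injective (trans (sym (ℕₚ.+-suc _ (suc n))) eq))) i k ⟩
    Δs cs (Z (suc a) b ⊖ (Z (suc a) (suc b) ⊖ Z a (suc b))) i k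
      ≡⟨ trans (Δs-⊖ cs (Z (suc a) b) _ i k)
           (cong (ℤ._-_ (Δs cs (Z (suc a) b) i k)) (Δs-⊖ cs (Z (suc a) (suc b)) (Z a (suc b)) i k)) ⟩
    Δs cs (Z (suc a) b) i k ℤ.- (Δs cs (Z (suc a) (suc b)) i k ℤ.- Δs cs (Z a (suc b)) i k)
      ≡⟨ cong (λ y → Δs cs (Z (suc a) b) i k ℤ.- (Δs cs (Z (suc a) (suc b)) i k ℤ.- y))
           (Δs-Z (suc n) a (suc b) (ℕₚ.m≤n⇒m≤1+n a≤b) (trans (l₁ a b n) eq) i k) ⟩
    Δs cs (Z (suc a) b) i k ℤ.- (Δs cs (Z (suc a) (suc b)) i k ℤ.- V (suc n) a (suc b) i k)
      ≡⟨ close (λ a<b → Δs-Z (suc n) (suc a) b a<b (trans (l₂ a b n) eq))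
               (Δs-Z n (suc a) (suc b) (s≤s a≤b) (trans (l₃ a b n) eq))
               (ℕₚ.m≤n⇒m<n∨m≡n a≤b) ⟩
    V (2 ℕ.+ n) a b i k ∎
    where
    open ≡-Reasoning
    cs = upTo (suc n)
    l₁ : ∀ a b n → a ℕ.+ suc b ℕ.+ suc n ≡ a ℕ.+ b ℕ.+ suc (suc n)
    l₁ = ℕSolver.solve-∀
    l₂ : ∀ a b n → suc a ℕ.+ b ℕ.+ suc n ≡ a ℕ.+ b ℕ.+ suc (suc n)
    l₂ = ℕSolver.solve-∀
    l₃ : ∀ a b n → suc a ℕ.+ suc b ℕ.+ n ≡ a ℕ.+ b ℕ.+ suc (suc n)
    l₃ = ℕSolver.solve-∀
    l₄ : ∀ x y → x ℤ.- (x ℤ.- y) ≡ y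
    l₄ = solve-∀
    -- The induction hypotheses enter as arguments. The first is conditional because (a + 1 , b)
    -- stays in the region only for a < b.
    close : (a ℕ.< b → Δs cs (Z (suc a) b) ≈ V (suc n) (suc a) b) →
            Δs (upTo n) (Z (suc a) (suc b)) ≈ V n (suc a) (suc b) →
            a ℕ.< b ⊎ a ≡ b →
      Δs cs (Z (suc a) b) i k ℤ.- (Δs cs (Z (suc a) (suc b)) i k ℤ.- V (suc n) a (suc b) i k) ≡
      V (2 ℕ.+ n) a b i k
    close left both (inj₁ a<b) = trans
      (cong₂ (λ x y → x ℤ.- (y ℤ.- V (suc n) a (suc b) i k))
        (left a<b i k)
        (begin
          Δs cs (Z (suc a) (suc b)) i k
            ≡⟨ cong (λ F → F i k) (Δs-upTo-suc n (Z (suc a) (suc b))) ⟩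
          Δs (upTo n) (Δ n (Z (suc a) (suc b))) i k
            ≡⟨ Δs-Δ (upTo n) n (Z (suc a) (suc b)) i k ⟩
          Δ n (Δs (upTo n) (Z (suc a) (suc b))) i k
            ≡⟨ Δ-cong n both i k ⟩
          Δ n (V n (suc a) (suc b)) i k ∎))
      (sym (V-step n a b a<b i k))
    -- On the diagonal the first two series agree by `Z-diagonal` and cancel, leaving the one term
    -- that `V-diagonal` gives for words.
    close left both (inj₂ refl) = trans
      (cong (λ x → x ℤ.- (Δs cs (Z (suc a) (suc a)) i k ℤ.- V (suc n) a (suc a) i k))
        (Δs-cong cs (Z-diagonal a) i k))
      (trans (l₄ (Δs cs (Z (suc a) (suc a)) i k) (V (suc n) a (suc a) i k)) (sym (V-diagonal n a i k)))

  maxRank≡N : maxRank ≡ N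
  maxRank≡N with x , αx≡0 , βx≡0 ← point 0 0 z≤n z≤n = foldr-⊔ ρ elements
    (λ y → ℕₚ.≤-trans (ℕₚ.m≤n+m (ρ y) (α y ℕ.+ β y)) (ℕₚ.≤-reflexive (rank y)))
    (complete x)
    (trans (cong₂ (λ a b → a ℕ.+ b ℕ.+ ρ x) (sym αx≡0) (sym βx≡0)) (rank x))

  numerator-V : numerator P ≈ V (suc N) 0 0
  numerator-V i k = begin
    numerator P i k
      ≡⟨ ⊛-∏ (zeta P) (upTo (suc maxRank)) i k ⟩
    Δs (upTo (suc maxRank)) (zeta P) i k
      ≡⟨ cong (λ n → Δs (upTo (suc n)) (zeta P) i k) maxRank≡N ⟩
    Δs (upTo (suc N)) (zeta P) i k
      ≡⟨ Δs-cong (upTo (suc N)) zeta-Z i k ⟩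
    Δs (upTo (suc N)) (Z 0 0) i k
      ≡⟨ Δs-Z (suc N) 0 0 z≤n refl i k ⟩
    V (suc N) 0 0 i k ∎
    where open ≡-Reasoning


-- The type C root poset

-- This numbers the chain of tips from the top down: `inj₂ 0` to `inj₂ r` receive 0 to r, then
-- `inj₁ r` down to `inj₁ 0` receive r + 1 to 2r + 1.
tipCoord : ∀ {r} → Tip (suc r) → ℕ
tipCoord {r} (inj₁ j) = r ℕ.+ suc r ℕ.∸ toℕ j
tipCoord     (inj₂ j) = toℕ j

toℕ≤r+1+r : ∀ {r} (j : Fin (suc r)) → toℕ j ℕ.≤ r ℕ.+ suc r
toℕ≤r+1+r {r} j = ℕₚ.≤-trans (ℕ.s≤s⁻¹ (Finₚ.toℕ<n j)) (ℕₚ.m≤m+n r (suc r))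

tipCoord-inj₁ : ∀ {r} (j : Fin (suc r)) → tipCoord (inj₁ j) ℕ.+ toℕ j ≡ r ℕ.+ suc r
tipCoord-inj₁ j = ℕₚ.m∸n+n≡m (toℕ≤r+1+r j)

-- Indices are at most r, while coordinates of tips `inj₁ j` start at r + 1. This separates the two
-- kinds of tips and also yields α ≤ β for the roots eᵢ - eⱼ.
toℕ<tipCoord-inj₁ : ∀ {r} (i j : Fin (suc r)) → toℕ i ℕ.< tipCoord (inj₁ j)
toℕ<tipCoord-inj₁ {r} i j = ℕₚ.<-≤-trans (Finₚ.toℕ<n i) (ℕₚ.≤-trans
  (ℕₚ.≤-reflexive (sym (ℕₚ.m+n∸m≡n r (suc r))))
  (ℕₚ.∸-monoʳ-≤ (r ℕ.+ suc r) (ℕ.s≤s⁻¹ (Finₚ.toℕ<n j))))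

⊑⇒tipCoord : ∀ {r} (s t : Tip (suc r)) → s ⊑ t → tipCoord t ℕ.≤ tipCoord s
⊑⇒tipCoord {r} (inj₁ j) (inj₁ j′) j≤j′ = ℕₚ.∸-monoʳ-≤ (r ℕ.+ suc r) j≤j′
⊑⇒tipCoord     (inj₁ j) (inj₂ j′) _    = ℕₚ.<⇒≤ (toℕ<tipCoord-inj₁ j′ j)
⊑⇒tipCoord     (inj₂ j) (inj₂ j′) j′≤j = j′≤j

tipCoord⇒⊑ : ∀ {r} (s t : Tip (suc r)) → tipCoord t ℕ.≤ tipCoord s → s ⊑ t
tipCoord⇒⊑ (inj₁ j) (inj₁ j′) p = ℕₚ.∸-cancelʳ-≤ (toℕ≤r+1+r j) p
tipCoord⇒⊑ (inj₁ j) (inj₂ j′) p = _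
tipCoord⇒⊑ (inj₂ j) (inj₁ j′) p = contradiction p (ℕₚ.<⇒≱ (toℕ<tipCoord-inj₁ j j′))
tipCoord⇒⊑ (inj₂ j) (inj₂ j′) p = p

suc-rk : ∀ {r} (x : PosRoot r) → suc (rk x) ≡ tipHt (lo x) (tip x)
suc-rk x = trans (ℕₚ.suc-pred (ht x) {{ℕ.>-nonZero (1≤ht x)}}) (ht≡tipHt x)

-- With indices from 0 to r, the root eᵢ - eⱼ has height j - i and second coordinate 2r + 1 - j,
-- while eᵢ + eⱼ has height 2r + 1 - i - j and second coordinate j. In both cases the coordinates
-- and the height add up to 2r + 1.
rank-coord : ∀ {r} (i : Fin (suc r)) t k → Valid i t → suc k ≡ tipHt i t →
             toℕ i ℕ.+ tipCoord t ℕ.+ k ≡ r ℕ.+ r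
rank-coord {r} i (inj₁ j) k i<j eq = ℕₚ.suc-injective (begin
  suc (toℕ i ℕ.+ b ℕ.+ k)     ≡⟨ l (toℕ i) b k ⟩
  b ℕ.+ (suc k ℕ.+ toℕ i)     ≡⟨ cong (λ h → b ℕ.+ (h ℕ.+ toℕ i)) eq ⟩
  b ℕ.+ (tipHt i (inj₁ j) ℕ.+ toℕ i) ≡⟨ cong (b ℕ.+_) (sum-minus i j i<j) ⟩
  b ℕ.+ toℕ j                 ≡⟨ tipCoord-inj₁ j ⟩
  r ℕ.+ suc r                 ≡⟨ ℕₚ.+-suc r r ⟩
  suc (r ℕ.+ r)               ∎)
  where
  open ≡-Reasoning
  b = tipCoord (inj₁ j)
  l : ∀ i b k → suc (i ℕ.+ b ℕ.+ k) ≡ b ℕ.+ (suc k ℕ.+ i)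
  l = ℕSolver.solve-∀
rank-coord {r} i (inj₂ j) k i≤j eq = ℕₚ.suc-injective (ℕₚ.suc-injective (begin
  suc (suc (toℕ i ℕ.+ toℕ j ℕ.+ k))        ≡⟨ l (toℕ i) (toℕ j) k ⟩
  suc (suc k) ℕ.+ (toℕ i ℕ.+ toℕ j)        ≡⟨ cong (λ h → suc h ℕ.+ (toℕ i ℕ.+ toℕ j)) eq ⟩
  suc (tipHt i (inj₂ j)) ℕ.+ (toℕ i ℕ.+ toℕ j) ≡⟨ sum-plus i j ⟩
  suc r ℕ.+ suc r                          ≡⟨ cong suc (ℕₚ.+-suc r r) ⟩
  suc (suc (r ℕ.+ r))                      ∎))
  where
  open ≡-Reasoning
  l : ∀ i j k → suc (suc (i ℕ.+ j ℕ.+ k)) ≡ suc (suc k) ℕ.+ (i ℕ.+ j)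
  l = ℕSolver.solve-∀

lo≤tipCoord : ∀ {r} (i : Fin (suc r)) t → Valid i t → toℕ i ℕ.≤ tipCoord t
lo≤tipCoord i (inj₁ j) _   = ℕₚ.<⇒≤ (toℕ<tipCoord-inj₁ i j)
lo≤tipCoord i (inj₂ j) i≤j = i≤j

-- A value b ≤ r is the coordinate of `inj₂ b`. A larger b belongs to `inj₁ j` with j = 2r + 1 - b,
-- and then a + b ≤ 2r says precisely that a < j, as eᵢ - eⱼ with i = a demands.
coord-root : ∀ r a b → a ℕ.≤ b → a ℕ.+ b ℕ.≤ r ℕ.+ r →
             ∃ λ (x : PosRoot (suc r)) → toℕ (lo x) ≡ a × tipCoord (tip x) ≡ b
coord-root r a b a≤b a+b≤2r with b ℕ.≤? r
... | yes b≤r with x , lo≡ , tip≡ ← root (fromℕ< (s≤s (ℕₚ.≤-trans a≤b b≤r))) (inj₂ (fromℕ< (s≤s b≤r)))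
                     (subst₂ ℕ._≤_ (sym (Finₚ.toℕ-fromℕ< _)) (sym (Finₚ.toℕ-fromℕ< _)) a≤b)
  = x , trans (cong toℕ lo≡) (Finₚ.toℕ-fromℕ< _) , trans (cong tipCoord tip≡) (Finₚ.toℕ-fromℕ< _)
coord-root r a b a≤b a+b≤2r | no b≰r
  = proj₁ made , trans (cong toℕ (proj₁ (proj₂ made))) (Finₚ.toℕ-fromℕ< _) ,
    trans (cong tipCoord (proj₂ (proj₂ made))) (trans (cong (r ℕ.+ suc r ℕ.∸_) (Finₚ.toℕ-fromℕ< (s≤s j≤r))) (ℕₚ.m∸[m∸n]≡n b≤))
  where
  r<b = ℕₚ.≰⇒> b≰r
  a≤r : a ℕ.≤ r
  a≤r = ℕₚ.+-cancelʳ-≤ r a r (ℕₚ.≤-trans (ℕₚ.+-monoʳ-≤ a (ℕₚ.<⇒≤ r<b)) a+b≤2r)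
  a+b<2r+1 : suc (a ℕ.+ b) ℕ.≤ r ℕ.+ suc r
  a+b<2r+1 = ℕₚ.≤-trans (s≤s a+b≤2r) (ℕₚ.≤-reflexive (sym (ℕₚ.+-suc r r)))
  b≤ : b ℕ.≤ r ℕ.+ suc r
  b≤ = ℕₚ.≤-trans (ℕₚ.m≤n+m b (suc a)) a+b<2r+1
  j≤r : r ℕ.+ suc r ℕ.∸ b ℕ.≤ r
  j≤r = ℕₚ.≤-trans (ℕₚ.∸-monoʳ-≤ (r ℕ.+ suc r) r<b) (ℕₚ.≤-reflexive (ℕₚ.m+n∸n≡m r (suc r)))
  a<j : suc a ℕ.≤ r ℕ.+ suc r ℕ.∸ b
  a<j = ℕₚ.≤-trans (ℕₚ.≤-reflexive (sym (ℕₚ.m+n∸n≡m (suc a) b))) (ℕₚ.∸-monoˡ-≤ b a+b<2r+1)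
  made = root (fromℕ< (s≤s a≤r)) (inj₁ (fromℕ< (s≤s j≤r)))
    (subst₂ ℕ._<_ (sym (Finₚ.toℕ-fromℕ< _)) (sym (Finₚ.toℕ-fromℕ< _)) a<j)

triangleC : ∀ r → Triangle (Φ⁺C (suc r)) (r ℕ.+ r)
triangleC r = record
  { α     = λ x → toℕ (lo x)
  ; β     = λ x → tipCoord (tip x)
  ; ≤⇒    = λ {x} {y} x≼y → let p , q = ≼⇒≼ᵉ {α = x} {y} x≼y in p , ⊑⇒tipCoord (tip x) (tip y) q
  ; ⇒≤    = λ {x} {y} (p , q) → ≼ᵉ⇒≼ {α = x} {y} (p , tipCoord⇒⊑ (tip x) (tip y) q)
  ; α≤β   = λ x → lo≤tipCoord (lo x) (tip x) (valid x)
  ; rank  = λ x → rank-coord (lo x) (tip x) (rk x) (valid x) (suc-rk x)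
  ; point = coord-root r
  }

-- Comparison of the numerator with the word polynomial

numerator-wordPolynomial : ∀ r → numerator (Φ⁺C (suc r)) ≈ wordPolynomial (suc r)
numerator-wordPolynomial r i n = begin
  numerator (Φ⁺C (suc r)) i n                ≡⟨ numerator-V (triangleC r) i n ⟩
  V (suc (r ℕ.+ r)) 0 0 i n                  ≡⟨ cong (λ N → V (suc N) 0 0 i n) (length≡ r) ⟨
  V (suc (2 ℕ.* suc r ℕ.∸ 2)) 0 0 i n        ≡⟨ wordPolynomial-V (suc r) i n ⟨
  wordPolynomial (suc r) i n                 ∎
  where
  open ≡-Reasoning
  length≡ : ∀ r → 2 ℕ.* suc r ℕ.∸ 2 ≡ r ℕ.+ r
  length≡ r = trans (cong (ℕ._∸ 1) (ℕₚ.+-suc r (r ℕ.+ 0))) (cong (r ℕ.+_) (ℕₚ.+-identityʳ r))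

corollary8p2 : (r : ℕ) → .{{_ : NonZero r}} →
    (numerator (Φ⁺C r) ≈ wordPolynomial r) ×
    (∀ i n → 0ℤ ≤ numerator (Φ⁺C r) i n)
corollary8p2 (suc r) = numerator-wordPolynomial r , λ i n →
  -- Each coefficient of the word polynomial is a sum of natural numbers, one for every word.
  subst (0ℤ ≤_) (sym (numerator-wordPolynomial r i n))
    (total-nonneg (ℬ (suc r)) _ λ w → ℤ.+≤+ z≤n)
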